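{- Let $H_3$ be the Heisenberg group over $\mathbb Z_3$, i.e. $\{x^ay^bz^c:0\le a,b,c<3\}$ with relations $x^3=y^3=z^3=1$, $xz=zx$, $yz=zy$, $yx=xyz$. Let $\mathscr S(H_3)$ be the set of integer group determinants $\det(a_{gh^{ -1}})_{g,h\in H_3}$ with all $a_g\in\mathbb Z$, and let $\mathscr S_1(H_3)$, resp. $\mathscr S_0(H_3)$, be the elements of $\mathscr S(H_3)$ not divisible, resp. divisible, by $3$. Then $$\mathscr S_1(H_3)=\{m\in\mathbb Z: m\equiv\pm1\pmod{27}\},\qquad \mathscr S_0(H_3)=3^{12}\mathbb Z.$$ -}

module Defs where

open import Data.Nat as ℕ using (ℕ; zero; suc)
open import Data.Nat.DivMod using (_mod_; _/_)
open import Data.Fin using (Fin; toℕ; punchIn) renaming (zero to fz; suc to fs)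
open import Data.Integer using (ℤ; +_; -_; _+_; _*_)
open import Data.Product using (_×_; _,_; ∃)
open import Relation.Binary.PropositionalEquality using (_≡_)

_⊕_ : Fin 3 → Fin 3 → Fin 3
a ⊕ b = (toℕ a ℕ.+ toℕ b) mod 3

⊝_ : Fin 3 → Fin 3
⊝ a = (3 ℕ.∸ toℕ a) mod 3

_⊗_ : Fin 3 → Fin 3 → Fin 3
a ⊗ b = (toℕ a ℕ.* toℕ b) mod 3

-- The Heisenberg group H₃: the triple (a , b , c) stands for x^a y^b z^c.
H₃ : Set
H₃ = Fin 3 × Fin 3 × Fin 3

-- Using y x = x y z (z central): y^b x^a' = x^a' y^b z^(a' b), hence
-- (x^a y^b z^c)(x^a' y^b' z^c') = x^(a+a') y^(b+b') z^(c+c'+a' b).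
_·_ : H₃ → H₃ → H₃
(a , b , c) · (a' , b' , c') = (a ⊕ a') , (b ⊕ b') , ((c ⊕ c') ⊕ (a' ⊗ b))

_⁻¹ : H₃ → H₃
(a , b , c) ⁻¹ = (⊝ a) , (⊝ b) , ((a ⊗ b) ⊕ (⊝ c))

enum : Fin 27 → H₃
enum i = ((toℕ i / 9) mod 3) , ((toℕ i / 3) mod 3) , (toℕ i mod 3)

∑ : (n : ℕ) → (Fin n → ℤ) → ℤ
∑ zero    f = + 0
∑ (suc n) f = f fz + ∑ n (λ i → f (fs i))

sgn : ℕ → ℤ
sgn zero    = + 1
sgn (suc k) = - sgn k

det : (n : ℕ) → (Fin n → Fin n → ℤ) → ℤ
det zero    M = + 1
det (suc n) M = ∑ (suc n) (λ j → sgn (toℕ j) * (M fz j * det n (λ i k → M (fs i) (punchIn j k))))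

-- The group determinant det(a_{g h⁻¹})_{g,h ∈ H₃} (rows/columns ordered by enum;
-- the determinant does not depend on the ordering).
groupDet : (H₃ → ℤ) → ℤ
groupDet a = det 27 (λ i j → a (enum i · (enum j ⁻¹)))

InS : ℤ → Set
InS m = ∃ λ (a : H₃ → ℤ) → groupDet a ≡ m

{-# OPTIONS --safe #-}

-- Let s be the sum of the values of f : H₃ → ℤ. Over ℤ[ω] the matrix f(g h⁻¹) is conjugate to a block
-- diagonal matrix: its blocks are the nine linear characters and three copies each of ρ(f) and of its
-- conjugate, ρ being the 3-dimensional representation. Hence the group determinant is
-- s · N₁N₂N₃N₄ · N(Δ)³, where Nᵢ is the norm of the two nontrivial characters that are constant on the
-- i-th class of parallel lines of H₃/⟨z⟩ = 𝔽₃², and Δ = det ρ(f).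
--
-- Summing f along ⟨z⟩ gives nine integers on 𝔽₃². With eᵢ the second symmetric function of the three
-- sums over the lines of class i, Nᵢ = s² - 3eᵢ. With E₂, E₃ the symmetric functions of the nine
-- integers, L the sum of the products over the twelve lines, and K = E₃ - L, one has Σ eᵢ = 3E₂,
-- Σ eᵢeⱼ ≡ sK mod 3 and Δ ≡ X mod 3(ω - 1) with X = s³ + 3(K - sE₂), so that N(Δ) ≡ X² mod 9.
-- Expanding, the determinant is s²⁷ mod 27, which settles the case 3 ∤ s. If 3 | s then each Nᵢ is
-- divisible by 3 and N(Δ) by 9, which accounts for 3¹¹; a further 3 comes from Σ eᵢ² ≡ 0 mod 3, which
-- forces some eᵢ to be divisible by 3.
--
-- Conversely, adding a constant c to f changes s by 27c and no other factor, so it suffices to exhibit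
-- f with s = ±1 and cofactor 1, and for every residue class of s in 3ℤ/27ℤ one with cofactor 3¹¹.
module Submission where

open import Algebra.Bundles using (CommutativeRing)
open import Algebra.Morphism.Structures using (IsRingHomomorphism)
open import Algebra.Structures using (IsCommutativeRing)
open import Data.Bool.Base using (if_then_else_)
open import Data.Empty using (⊥-elim)
open import Data.Fin.Base
  using (Fin; zero; suc; toℕ; punchIn; punchOut; pinch; combine; quotient; remainder; splitAt; _↑ˡ_; _↑ʳ_)
open import Data.Fin.Patterns
open import Data.Fin.Permutation using (Permutation′; permutation; _⟨$⟩ʳ_)
open import Data.Fin.Properties
  using (_≟_; all?; suc-injective; ↑ˡ-injective; punchIn-punchOut; splitAt-↑ˡ; splitAt-↑ʳ; splitAt⁻¹-↑ˡ)
open import Data.Integer as Int using (ℤ; +_)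
open import Data.Integer.DivMod using (_/ℕ_; _%ℕ_; a≡a%ℕn+[a/ℕn]*n; n%ℕd<d)
open import Data.Integer.Divisibility using (_∣_)
open import Data.Integer.Divisibility.Signed as Signed using (divides; ∣ᵤ⇒∣; ∣⇒∣ᵤ)
import Data.Integer.Properties as ℤₚ
import Data.Integer.Solver
open import Data.Integer.Tactic.RingSolver using (solve-∀)
open import Data.Nat as ℕ using (ℕ; zero; suc; s≤s; _^_)
open import Data.Product using (_×_; _,_; ∃; proj₁; proj₂)
open import Data.Product.Properties using (≡-dec)
open import Data.Sum using (_⊎_; inj₁; inj₂; map₁; [_,_]′)
open import Data.Vec.Functional as Vector using (tail; insertAt)
open import Data.Vec.Functional.Properties using (insertAt-lookup; insertAt-punchIn)
open import Function.Base using (_∘_)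
open import Function.Bundles using (_⇔_; mk⇔)
open import Level using (_⊔_)
open import Relation.Binary.Definitions using (DecidableEquality)
open import Relation.Binary.PropositionalEquality as ≡ using (_≡_; _≢_)
open import Relation.Nullary using (¬_; yes; no; does; contradiction)
open import Relation.Nullary.Decidable using (from-yes; from-no; map′; _×-dec_)
import Algebra.Properties.CommutativeSemigroup
import Algebra.Properties.Ring
import Algebra.Properties.Semiring.Sum
import Algebra.Solver.Ring.NaturalCoefficients.Default
import Algebra.Solver.Ring.Simple
open import Algebra.Solver.Ring.AlmostCommutativeRing using (fromCommutativeRing)
import Relation.Binary.Reasoning.Setoid

-- The obstacle is size: the defining expansion has 27! terms, so nothing about the group
-- determinant can be read off by evaluation. Determinants are therefore handled through one
-- principle, that an alternating form is determined by its value at the identity matrix; the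
-- product rule and the block rule are two instances of it.
--
-- The matrix P of characters and matrix coefficients is not invertible over ℤ[ω], so the block form
-- is reached without inverting it. One has M P = P B, and P times its weighted adjoint is 27 times
-- the identity, so det P divides a nonzero integer and can be cancelled from det M · det P = det P
-- · det B.
--
-- Modulo 27 everything rests on one cancellation. With t = s³ and Z = K - sE₂ the linear characters
-- contribute t³ + 9t²Z and N(Δ)³ contributes t⁶ + 18t⁵Z; in the product the two multiples of t⁸Z
-- add up to 27t⁸Z.

-- Determinants over a commutative ring

module Determinant {c ℓ} (R : CommutativeRing c ℓ) where

  open CommutativeRing R hiding (zero)
  open Vector using (_∷_)
  open Algebra.Properties.Ring ring using (-‿distribˡ-*; -‿distribʳ-*; -1*x≈-x; -‿involutive)
  open Algebra.Properties.Semiring.Sum semiring public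
  open Relation.Binary.Reasoning.Setoid setoid
  open Algebra.Solver.Ring.NaturalCoefficients.Default commutativeSemiring using (solve; _:+_; _:*_; _:=_)

  Row : ℕ → Set c
  Row n = Fin n → Carrier

  Matrix : ℕ → ℕ → Set c
  Matrix m n = Fin m → Row n

  infix 4 _≋_
  _≋_ : ∀ {n} → Row n → Row n → Set ℓ
  u ≋ v = ∀ j → u j ≈ v j

  sign : ℕ → Carrier
  sign zero    = 1#
  sign (suc k) = - sign k

  minor : ∀ {m n} → Matrix (suc m) (suc n) → Fin (suc n) → Matrix m n
  minor A j i k = A (suc i) (punchIn j k)

  det : ∀ n → Matrix n n → Carrier
  det zero    A = 1#
  det (suc n) A = sum λ j → sign (toℕ j) * (A zero j * det n (minor A j))

  laplace : ∀ {n} → Matrix (suc n) (suc n) → Row (suc n)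
  laplace {n} A j = sign (toℕ j) * (A zero j * det n (minor A j))

  infixl 7 _⊡_
  _⊡_ : ∀ {l m n} → Matrix l m → Matrix m n → Matrix l n
  (A ⊡ B) i k = sum λ j → A i j * B j k

  𝟙 : ∀ {n} → Matrix n n
  𝟙 zero    zero    = 1#
  𝟙 zero    (suc j) = 0#
  𝟙 (suc i) zero    = 0#
  𝟙 (suc i) (suc j) = 𝟙 i j

  sum-cong : ∀ {n} (f g : Row n) → f ≋ g → sum f ≈ sum g
  sum-cong f g = sum-cong-≋ {_} {f} {g}

  sum-zero : ∀ {n} (f : Fin n → Carrier) → (∀ j → f j ≈ 0#) → sum f ≈ 0#
  sum-zero {n} f f≈0 = trans (sum-cong-≋ f≈0) (sum-replicate-zero n)

  sum-linear : ∀ {n} x (f g : Fin n → Carrier) → sum (λ j → x * f j + g j) ≈ x * sum f + sum g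
  sum-linear x f g = trans (∑-distrib-+ (λ j → x * f j) g) (+-congʳ (sym (*-distribˡ-sum x f)))

  sum-𝟙ʳ : ∀ {n} (f : Row n) k → sum (λ j → f j * 𝟙 j k) ≈ f k
  sum-𝟙ʳ f zero = trans (+-cong (*-identityʳ _) (sum-zero (λ j → f (suc j) * 0#) λ j → zeroʳ _)) (+-identityʳ _)
  sum-𝟙ʳ f (suc k) = trans (+-cong (zeroʳ _) (sum-𝟙ʳ (f ∘ suc) k)) (+-identityˡ _)

  sum-𝟙ˡ : ∀ {n} (f : Row n) i → sum (λ j → 𝟙 i j * f j) ≈ f i
  sum-𝟙ˡ f zero = trans (+-cong (*-identityˡ _) (sum-zero (λ j → 0# * f (suc j)) λ j → zeroˡ _)) (+-identityʳ _)
  sum-𝟙ˡ f (suc i) = trans (+-cong (zeroˡ _) (sum-𝟙ˡ (f ∘ suc) i)) (+-identityˡ _)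

  -- Alternating multilinear forms

  -- Linearity relates three matrices that agree off row `i`, instead of updating a row of one
  -- matrix, so that it applies to rows known only up to pointwise equality. Rows and columns are
  -- counted separately because fixing the first row of a square matrix leaves a form on rectangular
  -- ones.
  record Alternating {m n} (D : Matrix m n → Carrier) : Set (c ⊔ ℓ) where
    field
      D-cong      : ∀ A B → (∀ i → A i ≋ B i) → D A ≈ D B
      linear      : ∀ i x A B C → (∀ j → A i j ≈ x * B i j + C i j) →
                    (∀ k → k ≢ i → A k ≋ B k × A k ≋ C k) → D A ≈ x * D B + D C
      alternating : ∀ i k A → i ≢ k → A i ≋ A k → D A ≈ 0#

  module _ {m n} {D : Matrix m n → Carrier} (alt : Alternating D) where
    open Alternating alt

    zero-row : ∀ i A → (∀ j → A i j ≈ 0#) → D A ≈ 0#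
    zero-row i A Aᵢ≈0 = begin
      -- A zero row is `- 1#` times itself plus itself, so `A` can play all three parts in `linear`.
      D A                ≈⟨ linear i (- 1#) A A A (λ j → trans (Aᵢ≈0 j)
          (sym (trans (+-congʳ (-1*x≈-x _)) (-‿inverseˡ _)))) (λ _ _ → (λ _ → refl) , (λ _ → refl)) ⟩
      - 1# * D A + D A   ≈⟨ +-congʳ (-1*x≈-x _) ⟩
      - D A + D A        ≈⟨ -‿inverseˡ _ ⟩
      0#                 ∎

    additive : ∀ i A B C → (∀ j → A i j ≈ B i j + C i j) →
               (∀ k → k ≢ i → A k ≋ B k × A k ≋ C k) → D A ≈ D B + D C
    additive i A B C Aᵢ same =
      trans (linear i 1# A B C (λ j → trans (Aᵢ j) (+-congʳ (sym (*-identityˡ _)))) same) (+-congʳ (*-identityˡ _))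

    module _ (A : Matrix m n) (i k : Fin m) where

      replace₂ : Row n → Row n → Matrix m n
      replace₂ u v l with l ≟ i | l ≟ k
      ... | yes _ | _     = u
      ... | no  _ | yes _ = v
      ... | no  _ | no  _ = A l

      replace₂-fst : ∀ u v → replace₂ u v i ≡ u
      replace₂-fst u v with i ≟ i
      ... | yes _   = ≡.refl
      ... | no  i≢i = contradiction ≡.refl i≢i

      replace₂-snd : ∀ u v → i ≢ k → replace₂ u v k ≡ v
      replace₂-snd u v i≢k with k ≟ i | k ≟ k
      ... | yes k≡i | _       = contradiction (≡.sym k≡i) i≢k
      ... | no  _   | yes _   = ≡.refl
      ... | no  _   | no  k≢k = contradiction ≡.refl k≢k

      replace₂-off-fst : ∀ u u′ v l → l ≢ i → replace₂ u v l ≡ replace₂ u′ v l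
      replace₂-off-fst u u′ v l l≢i with l ≟ i | l ≟ k
      ... | yes l≡i | _     = contradiction l≡i l≢i
      ... | no  _   | yes _ = ≡.refl
      ... | no  _   | no  _ = ≡.refl

      replace₂-off-snd : ∀ u v v′ l → l ≢ k → replace₂ u v l ≡ replace₂ u v′ l
      replace₂-off-snd u v v′ l l≢k with l ≟ i | l ≟ k
      ... | yes _ | _       = ≡.refl
      ... | no  _ | yes l≡k = contradiction l≡k l≢k
      ... | no  _ | no  _   = ≡.refl

    ≡⇒≋ : ∀ {u v : Row n} → u ≡ v → u ≋ v
    ≡⇒≋ ≡.refl j = refl

    -- Polarisation: the form vanishes when rows `i` and `k` are both `u + v`, and expanding it
    -- leaves only the two mixed terms. `B` is a separate matrix described pointwise, so that
    -- callers need not present it as an explicit exchange of rows.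
    antisymmetric : ∀ i k → i ≢ k → ∀ A B → A i ≋ B k → A k ≋ B i →
                    (∀ l → l ≢ i → l ≢ k → A l ≋ B l) → D A ≈ - D B
    antisymmetric i k i≢k A B Aᵢ Aₖ same = begin
      D A                                   ≈⟨ D-cong A (M u v) A≋ ⟩
      F u v                                 ≈⟨ solve′ (F u v) (F v u) ⟩
      (F u v + F v u) - F v u               ≈⟨ +-congʳ cancel ⟩
      0# - F v u                            ≈⟨ +-identityˡ _ ⟩
      - F v u                               ≈⟨ -‿cong (D-cong (M v u) B B≋) ⟩
      - D B                                 ∎
      where
      u v w : Row n
      u = A i
      v = A k
      w j = u j + v j
      M = replace₂ A i k
      F : Row n → Row n → Carrier
      F x y = D (M x y)
      fst : ∀ x y → M x y i ≡ x
      fst = replace₂-fst A i k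
      snd : ∀ x y → M x y k ≡ y
      snd x y = replace₂-snd A i k x y i≢k
      solve′ : ∀ x y → x ≈ (x + y) - y
      solve′ x y = sym (trans (+-assoc _ _ _) (trans (+-congˡ (-‿inverseʳ y)) (+-identityʳ x)))
      A≋ : ∀ l → A l ≋ M u v l
      A≋ l with l ≟ i | l ≟ k
      ... | yes ≡.refl | _          = λ _ → refl
      ... | no  _      | yes ≡.refl = λ _ → refl
      ... | no  _      | no  _      = λ _ → refl
      B≋ : ∀ l → M v u l ≋ B l
      B≋ l with l ≟ i | l ≟ k
      ... | yes ≡.refl | _          = Aₖ
      ... | no  _      | yes ≡.refl = Aᵢ
      ... | no  l≢i    | no  l≢k    = same l l≢i l≢k
      addˡ : ∀ y → F w y ≈ F u y + F v y
      addˡ y = additive i (M w y) (M u y) (M v y)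
        (λ j → trans (≡⇒≋ (fst w y) j) (sym (+-cong (≡⇒≋ (fst u y) j) (≡⇒≋ (fst v y) j))))
        (λ l l≢i → ≡⇒≋ (replace₂-off-fst A i k w u y l l≢i) , ≡⇒≋ (replace₂-off-fst A i k w v y l l≢i))
      addʳ : ∀ x → F x w ≈ F x u + F x v
      addʳ x = additive k (M x w) (M x u) (M x v)
        (λ j → trans (≡⇒≋ (snd x w) j) (sym (+-cong (≡⇒≋ (snd x u) j) (≡⇒≋ (snd x v) j))))
        (λ l l≢k → ≡⇒≋ (replace₂-off-snd A i k x w u l l≢k) , ≡⇒≋ (replace₂-off-snd A i k x w v l l≢k))
      diag : ∀ x → F x x ≈ 0#
      diag x = alternating i k (M x x) i≢k (≡⇒≋ (≡.trans (fst x x) (≡.sym (snd x x))))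
      cancel : F u v + F v u ≈ 0#
      cancel = begin
        F u v + F v u                         ≈⟨ +-cong (sym (+-identityˡ _)) (sym (+-identityʳ _)) ⟩
        (0# + F u v) + (F v u + 0#)           ≈⟨ +-cong (+-congʳ (sym (diag u))) (+-congˡ (sym (diag v))) ⟩
        (F u u + F u v) + (F v u + F v v)     ≈⟨ +-cong (addʳ u) (addʳ v) ⟨
        F u w + F v w                         ≈⟨ addˡ w ⟨
        F w w                                 ≈⟨ diag w ⟩
        0#                                    ∎

  fix-first : ∀ {m n} {D : Matrix (suc m) n → Carrier} → Alternating D →
              ∀ (u : Row n) → Alternating (λ A → D (u ∷ A))
  fix-first {D = D} alt u = record
    { D-cong      = λ A B A≋B → D-cong (u ∷ A) (u ∷ B) λ { zero j → refl ; (suc i) → A≋B i }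
    ; linear      = λ i x A B C Aᵢ same → linear (suc i) x (u ∷ A) (u ∷ B) (u ∷ C) Aᵢ
                      λ { zero _ → (λ _ → refl) , (λ _ → refl) ; (suc k) k≢i → same k (k≢i ∘ ≡.cong suc) }
    ; alternating = λ i k A i≢k Aᵢ≋Aₖ → alternating (suc i) (suc k) (u ∷ A) (i≢k ∘ suc-injective) Aᵢ≋Aₖ
    }
    where open Alternating alt

  -- The Laplace expansion is an alternating form

  det-cong : ∀ n A B → (∀ i → A i ≋ B i) → det n A ≈ det n B
  det-cong zero    A B A≋B = refl
  det-cong (suc n) A B A≋B = sum-cong (laplace A) (laplace B) λ j → *-congˡ {sign (toℕ j)}
    (*-cong (A≋B zero j) (det-cong n _ _ λ i k → A≋B (suc i) (punchIn j k)))

  det-linear : ∀ n i x A B C → (∀ j → A i j ≈ x * B i j + C i j) →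
               (∀ k → k ≢ i → A k ≋ B k × A k ≋ C k) → det n A ≈ x * det n B + det n C
  det-linear (suc n) zero x A B C A₀ same =
    trans (sum-cong (laplace A) (λ j → x * laplace B j + laplace C j) expand) (sum-linear x (laplace B) (laplace C))
    where
    expand : ∀ j → laplace A j ≈ x * laplace B j + laplace C j
    expand j = begin
      laplace A j
        ≈⟨ *-congˡ (*-congʳ (A₀ j)) ⟩
      sign (toℕ j) * ((x * B zero j + C zero j) * det n (minor A j))
        ≈⟨ solve 5 (λ s x b c d → (s :* ((x :* b :+ c) :* d)) := (x :* (s :* (b :* d)) :+ s :* (c :* d))) refl
             (sign (toℕ j)) x (B zero j) (C zero j) (det n (minor A j)) ⟩
      x * (sign (toℕ j) * (B zero j * det n (minor A j))) + sign (toℕ j) * (C zero j * det n (minor A j))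
        ≈⟨ +-cong (*-congˡ (*-congˡ (*-congˡ (det-cong n _ _ λ i k → proj₁ (same (suc i) λ ()) (punchIn j k)))))
                  (*-congˡ (*-congˡ (det-cong n _ _ λ i k → proj₂ (same (suc i) λ ()) (punchIn j k)))) ⟩
      x * laplace B j + laplace C j ∎
  det-linear (suc n) (suc i) x A B C Aᵢ same =
    trans (sum-cong (laplace A) (λ j → x * laplace B j + laplace C j) expand) (sum-linear x (laplace B) (laplace C))
    where
    expand : ∀ j → laplace A j ≈ x * laplace B j + laplace C j
    expand j = begin
      laplace A j
        ≈⟨ *-congˡ (*-congˡ (det-linear n i x _ _ _ (λ k → Aᵢ (punchIn j k))
             λ l l≢i → (λ k → proj₁ (same (suc l) (l≢i ∘ suc-injective)) (punchIn j k)) ,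
                       (λ k → proj₂ (same (suc l) (l≢i ∘ suc-injective)) (punchIn j k)))) ⟩
      sign (toℕ j) * (A zero j * (x * det n (minor B j) + det n (minor C j)))
        ≈⟨ solve 5 (λ s x a b c → (s :* (a :* (x :* b :+ c))) := (x :* (s :* (a :* b)) :+ s :* (a :* c))) refl
             (sign (toℕ j)) x (A zero j) (det n (minor B j)) (det n (minor C j)) ⟩
      x * (sign (toℕ j) * (A zero j * det n (minor B j))) + sign (toℕ j) * (A zero j * det n (minor C j))
        ≈⟨ +-cong (*-congˡ (*-congˡ (*-congʳ (proj₁ (same zero λ ()) j))))
            (*-congˡ (*-congʳ (proj₂ (same zero λ ()) j))) ⟩
      x * laplace B j + laplace C j ∎

  -- (j , k) ↦ (punchIn j k , pinch k j) is the involution exchanging the two members of an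
  -- ordered pair of distinct columns, the second being numbered within the complement of the first.
  sum-pairs-cancel : ∀ {n} (g : Fin (suc n) → Fin n → Carrier) →
                     (∀ j k → g j k + g (punchIn j k) (pinch k j) ≈ 0#) → sum (λ j → sum (g j)) ≈ 0#
  sum-pairs-cancel {zero}  g cancel = +-identityˡ _
  sum-pairs-cancel {suc n} g cancel = begin
    sum (g zero) + sum (λ j → g (suc j) zero + sum (λ k → g (suc j) (suc k)))
      ≈⟨ +-congˡ (∑-distrib-+ (λ j → g (suc j) zero) (λ j → sum (λ k → g (suc j) (suc k)))) ⟩
    sum (g zero) + (sum (λ j → g (suc j) zero) + sum (λ j → sum (λ k → g (suc j) (suc k))))
      ≈⟨ +-congˡ (+-congˡ (sum-pairs-cancel (λ j k → g (suc j) (suc k)) λ j k → cancel (suc j) (suc k))) ⟩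
    sum (g zero) + (sum (λ j → g (suc j) zero) + 0#)
      ≈⟨ +-congˡ (+-identityʳ _) ⟩
    sum (g zero) + sum (λ j → g (suc j) zero)
      ≈⟨ ∑-distrib-+ (g zero) (λ j → g (suc j) zero) ⟨
    sum (λ k → g zero k + g (suc k) zero)
      ≈⟨ sum-zero (λ k → g zero k + g (suc k) zero) (λ k → cancel zero k) ⟩
    0# ∎

  punchIn-pinch : ∀ {n} (j : Fin (suc n)) (k : Fin n) → punchIn (punchIn j k) (pinch k j) ≡ j
  punchIn-pinch {suc n} zero    k       = ≡.refl
  punchIn-pinch {suc n} (suc j) zero    = ≡.refl
  punchIn-pinch {suc n} (suc j) (suc k) = ≡.cong suc (punchIn-pinch j k)

  punchIn-punchIn : ∀ {n} (j : Fin (suc (suc n))) (k : Fin (suc n)) (c : Fin n) →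
                    punchIn (punchIn j k) (punchIn (pinch k j) c) ≡ punchIn j (punchIn k c)
  punchIn-punchIn zero    k       c       = ≡.refl
  punchIn-punchIn (suc j) zero    c       = ≡.refl
  punchIn-punchIn (suc j) (suc k) zero    = ≡.refl
  punchIn-punchIn (suc j) (suc k) (suc c) = ≡.cong suc (punchIn-punchIn j k c)

  -- Of two columns, the one further right drops by one when it is numbered in the complement of the
  -- other. Reversing the order of the pair thus changes the sum of the two positions by exactly
  -- one.
  sign-swap : ∀ {n} (j : Fin (suc n)) (k : Fin n) →
              sign (toℕ (punchIn j k)) * sign (toℕ (pinch k j)) ≈ - (sign (toℕ j) * sign (toℕ k))
  sign-swap {suc n} zero k = trans (*-identityʳ _) (-‿cong (sym (*-identityˡ _)))
  sign-swap {suc n} (suc j) zero = begin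
    1# * sign (toℕ j)          ≈⟨ *-identityˡ _ ⟩
    sign (toℕ j)               ≈⟨ -‿involutive _ ⟨
    - - sign (toℕ j)           ≈⟨ -‿cong (*-identityʳ _) ⟨
    - (- sign (toℕ j) * 1#)    ∎
  sign-swap {suc n} (suc j) (suc k) = begin
    - sign (toℕ (punchIn j k)) * - sign (toℕ (pinch k j))  ≈⟨ neg-neg _ _ ⟩
    sign (toℕ (punchIn j k)) * sign (toℕ (pinch k j))      ≈⟨ sign-swap j k ⟩
    - (sign (toℕ j) * sign (toℕ k))                        ≈⟨ -‿cong (neg-neg _ _) ⟨
    - (- sign (toℕ j) * - sign (toℕ k))                    ∎
    where
    neg-neg : ∀ x y → - x * - y ≈ x * y
    neg-neg x y = trans (sym (-‿distribˡ-* x (- y))) (trans (-‿cong (sym (-‿distribʳ-* x y))) (-‿involutive _))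

  -- Expanding along both rows gives a sum over ordered pairs of distinct columns. A pair and its
  -- reversal leave the same minor and, the rows being equal, the same product of entries, with
  -- opposite signs.
  det-equal-01 : ∀ n A → A zero ≋ A (suc zero) → det (suc (suc n)) A ≈ 0#
  det-equal-01 n A A₀≋A₁ = trans (sum-cong (laplace A) (λ j → sum (g j)) expand) (sum-pairs-cancel g cancel)
    where
    d : Fin (suc (suc n)) → Fin (suc n) → Carrier
    d j k = det n (λ i c → A (suc (suc i)) (punchIn j (punchIn k c)))
    g : Fin (suc (suc n)) → Fin (suc n) → Carrier
    g j k = sign (toℕ j) * (A zero j * (sign (toℕ k) * (A (suc zero) (punchIn j k) * d j k)))
    expand : ∀ j → laplace A j ≈ sum (g j)
    expand j = trans (*-congˡ (*-distribˡ-sum (A zero j) (laplace (minor A j))))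
                     (*-distribˡ-sum (sign (toℕ j)) (λ k → A zero j * laplace (minor A j) k))
    regroup : ∀ s a t b e → s * (a * (t * (b * e))) ≈ (s * t) * (a * b * e)
    regroup = solve 5 (λ s a t b e → (s :* (a :* (t :* (b :* e)))) := ((s :* t) :* (a :* b :* e))) refl
    cancel : ∀ j k → g j k + g (punchIn j k) (pinch k j) ≈ 0#
    cancel j k = begin
      g j k + g j′ k′
        ≈⟨ +-cong (regroup _ _ _ _ _) (regroup _ _ _ _ _) ⟩
      (sign (toℕ j) * sign (toℕ k)) * (A zero j * A (suc zero) j′ * d j k) +
        (sign (toℕ j′) * sign (toℕ k′)) * (A zero j′ * A (suc zero) (punchIn j′ k′) * d j′ k′)
        ≈⟨ +-cong (*-congˡ (*-congʳ (*-congˡ (sym (A₀≋A₁ j′)))))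
                  (*-cong (sign-swap j k) (*-cong (*-congˡ
                    (trans (sym (A₀≋A₁ _)) (reflexive (≡.cong (A zero) (punchIn-pinch j k)))))
                    (det-cong n _ _ λ i c → reflexive (≡.cong (A (suc (suc i))) (punchIn-punchIn j k c))))) ⟩
      (sign (toℕ j) * sign (toℕ k)) * (A zero j * A zero j′ * d j k) +
        (- (sign (toℕ j) * sign (toℕ k))) * (A zero j′ * A zero j * d j k)
        ≈⟨ +-congˡ (trans (sym (-‿distribˡ-* _ _)) (-‿cong (*-congˡ (*-congʳ (*-comm _ _))))) ⟩
      _ + - _
        ≈⟨ -‿inverseʳ _ ⟩
      0# ∎
      where
      j′ = punchIn j k
      k′ = pinch k j

  -- The minors are alternating by induction, so rows 1 and `suc k` of `A` may be exchanged inside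
  -- each of them at the cost of a sign; this brings the two equal rows next to each other at the
  -- top.
  det-equal-first : ∀ n → Alternating (det n) → ∀ k A → A zero ≋ A (suc k) → det (suc n) A ≈ 0#
  det-equal-first (suc n) _     zero    A eq = det-equal-01 n A eq
  det-equal-first (suc n) det-n (suc k) A eq = begin
    det (suc (suc n)) A       ≈⟨ sum-cong (laplace A) (λ j → - 1# * laplace (A zero ∷ B) j) swapped ⟩
    sum (λ j → - 1# * laplace (A zero ∷ B) j)
                              ≈⟨ *-distribˡ-sum (- 1#) (laplace (A zero ∷ B)) ⟨
    - 1# * det (suc (suc n)) (A zero ∷ B)
                              ≈⟨ *-congˡ (det-equal-01 n (A zero ∷ B) eq) ⟩
    - 1# * 0#                 ≈⟨ zeroʳ _ ⟩
    0#                        ∎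
    where
    B : Matrix (suc n) (suc (suc n))
    B zero    = A (suc (suc k))
    B (suc l) with l ≟ k
    ... | yes _ = A (suc zero)
    ... | no  _ = A (suc (suc l))
    Bₖ : A (suc zero) ≋ B (suc k)
    Bₖ with k ≟ k
    ... | yes _   = λ _ → refl
    ... | no  k≢k = contradiction ≡.refl k≢k
    B-other : ∀ l → l ≢ zero → l ≢ suc k → A (suc l) ≋ B l
    B-other zero    l≢0 _ = contradiction ≡.refl l≢0
    B-other (suc l) _ l≢k with l ≟ k
    ... | yes l≡k = contradiction (≡.cong suc l≡k) l≢k
    ... | no  _   = λ _ → refl
    swapped : ∀ j → laplace A j ≈ - 1# * laplace (A zero ∷ B) j
    swapped j = trans
      (*-congˡ (*-congˡ (trans (antisymmetric det-n zero (suc k) (λ ()) (minor A j) (minor (A zero ∷ B) j)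
        (λ c → Bₖ (punchIn j c)) (λ c → refl) (λ l l≢0 l≢k c → B-other l l≢0 l≢k (punchIn j c))) (sym (-1*x≈-x _)))))
      (solve 4 (λ s a m d → (s :* (a :* (m :* d))) := (m :* (s :* (a :* d)))) refl (sign (toℕ j)) (A zero j)
          (- 1#) (det (suc n) (minor (A zero ∷ B) j)))

  det-isAlternating : ∀ n → Alternating (det n)
  det-equal-rows : ∀ n i k A → i ≢ k → A i ≋ A k → det n A ≈ 0#
  det-equal-rows (suc n) zero    zero    A i≢k eq = contradiction ≡.refl i≢k
  det-equal-rows (suc n) zero    (suc k) A i≢k eq = det-equal-first n (det-isAlternating n) k A eq
  det-equal-rows (suc n) (suc i) zero    A i≢k eq = det-equal-first n (det-isAlternating n) i A (λ j → sym (eq j))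
  det-equal-rows (suc n) (suc i) (suc k) A i≢k eq = sum-zero (laplace A) λ j → trans
      (*-congˡ (trans (*-congˡ (det-equal-rows n i k (minor A j) (i≢k ∘ ≡.cong suc) λ c → eq (punchIn j c)))
          (zeroʳ _)))
      (zeroʳ _)

  det-isAlternating n = record { D-cong = det-cong n ; linear = det-linear n ; alternating = det-equal-rows n }

  -- Uniqueness of alternating forms

  combine-first : ∀ {m n p} {D : Matrix (suc m) n → Carrier} → Alternating D →
                  ∀ (x : Row p) (V : Matrix p n) A → A zero ≋ (λ c → sum λ t → x t * V t c) →
                  D A ≈ sum λ t → x t * D (V t ∷ tail A)
  combine-first {p = zero}  {D} alt x V A eq = zero-row alt zero A eq
  combine-first {p = suc p} {D} alt x V A eq = trans
    (linear zero (x zero) A (V zero ∷ tail A) (rest ∷ tail A) eq same)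
    (+-congˡ (combine-first alt (tail x) (tail V) (rest ∷ tail A) λ c → refl))
    where
    open Alternating alt
    rest : Row _
    rest c = sum λ t → x (suc t) * V (suc t) c
    same : ∀ k → k ≢ zero → A k ≋ (V zero ∷ tail A) k × A k ≋ (rest ∷ tail A) k
    same zero    0≢0 = contradiction ≡.refl 0≢0
    same (suc k) _   = (λ _ → refl) , (λ _ → refl)

  -- The induction fixes the first row once it has been replaced and passes to a function of the
  -- rows below it, which is why `D` is a bare function with the two properties that survive this
  -- passage. It serves to erase a column from all rows under a unit vector.
  change-rows : ∀ {m n} (D : Matrix m n → Carrier) (φ : Row n → Row n) →
                (∀ A B → (∀ i → A i ≋ B i) → D A ≈ D B) →
                (∀ i A B → B i ≋ φ (A i) → (∀ k → k ≢ i → A k ≋ B k) → D A ≈ D B) →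
                ∀ A → D A ≈ D (φ ∘ A)
  change-rows {zero}  D φ D-cong step A = D-cong A (φ ∘ A) λ ()
  change-rows {suc m} D φ D-cong step A = begin
    D A                       ≈⟨ step zero A (φ (A zero) ∷ tail A) (λ _ → refl)
                                   (λ { zero 0≢0 → contradiction ≡.refl 0≢0 ; (suc k) _ _ → refl }) ⟩
    D (φ (A zero) ∷ tail A)   ≈⟨ change-rows (λ T → D (φ (A zero) ∷ T)) φ
                                   (λ T U T≋U → D-cong _ _ λ { zero _ → refl ; (suc i) → T≋U i })
                                   (λ i T U eq same → step (suc i) _ _ eq
                                     λ { zero _ _ → refl ; (suc k) k≢i → same k (k≢i ∘ ≡.cong suc) })
                                   (tail A) ⟩
    D (φ (A zero) ∷ φ ∘ tail A) ≈⟨ D-cong _ _ (λ { zero _ → refl ; (suc i) _ → refl }) ⟩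
    D (φ ∘ A)                 ∎

  -- Row `j` reaches the top by `j` exchanges of neighbours.
  rotate-rows : ∀ {m n} {D : Matrix (suc m) n → Carrier} → Alternating D → ∀ (V : Matrix (suc m) n) j →
                D (V j ∷ V ∘ punchIn j) ≈ sign (toℕ j) * D V
  rotate-rows alt V zero = trans (D-cong _ _ λ { zero _ → refl ; (suc i) _ → refl }) (sym (*-identityˡ _))
    where open Alternating alt
  rotate-rows {suc m} {D = D} alt V (suc j) = begin
    D (V (suc j) ∷ V ∘ punchIn (suc j))
      ≈⟨ antisymmetric alt zero (suc zero) (λ ()) _ (V zero ∷ (V (suc j) ∷ V ∘ suc ∘ punchIn j))
           (λ _ → refl) (λ _ → refl)
           (λ { zero 0≢0 _ → contradiction ≡.refl 0≢0
              ; (suc zero) _ 1≢1 → contradiction ≡.refl 1≢1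
              ; (suc (suc l)) _ _ _ → refl }) ⟩
    - D (V zero ∷ (V (suc j) ∷ V ∘ suc ∘ punchIn j))
      ≈⟨ -‿cong (rotate-rows (fix-first alt (V zero)) (tail V) j) ⟩
    - (sign (toℕ j) * D (V zero ∷ tail V))
      ≈⟨ -‿distribˡ-* _ _ ⟩
    - sign (toℕ j) * D (V zero ∷ tail V)
      ≈⟨ *-congˡ (D-cong _ _ λ { zero _ → refl ; (suc i) _ → refl }) ⟩
    - sign (toℕ j) * D V ∎
    where open Alternating alt

  insertAt-0 : ∀ {n} (j c : Fin (suc n)) → insertAt {n = n} (λ _ → 0#) j 0# c ≈ 0#
  insertAt-0         zero    zero    = refl
  insertAt-0         zero    (suc c) = refl
  insertAt-0 {suc n} (suc j) zero    = refl
  insertAt-0 {suc n} (suc j) (suc c) = insertAt-0 j c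

  𝟙-punchIn : ∀ {n} (j : Fin (suc n)) i → insertAt (𝟙 {n} i) j 0# ≋ 𝟙 (punchIn j i)
  𝟙-punchIn         zero    i       zero    = refl
  𝟙-punchIn         zero    i       (suc c) = refl
  𝟙-punchIn {suc n} (suc j) zero    zero    = refl
  𝟙-punchIn {suc n} (suc j) zero    (suc c) = insertAt-0 j c
  𝟙-punchIn {suc n} (suc j) (suc i) zero    = refl
  𝟙-punchIn {suc n} (suc j) (suc i) (suc c) = 𝟙-punchIn j i c

  𝟙-diag : ∀ {n} (j : Fin n) → 𝟙 j j ≈ 1#
  𝟙-diag zero    = refl
  𝟙-diag (suc j) = 𝟙-diag j

  𝟙-off : ∀ {n} (j : Fin (suc n)) k → 𝟙 j (punchIn j k) ≈ 0#
  𝟙-off         zero    k       = refl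
  𝟙-off {suc n} (suc j) zero    = refl
  𝟙-off {suc n} (suc j) (suc k) = 𝟙-off j k

  by-punchIn : ∀ {n} {u v : Row (suc n)} j → u j ≈ v j → (∀ k → u (punchIn j k) ≈ v (punchIn j k)) → u ≋ v
  by-punchIn {u = u} {v} j at-j elsewhere c with j ≟ c
  ... | yes ≡.refl = at-j
  ... | no  j≢c    = ≡.subst (λ c → u c ≈ v c) (punchIn-punchOut j≢c) (elsewhere (punchOut j≢c))

  insert-alternating : ∀ {m n} {D : Matrix m (suc n) → Carrier} → Alternating D → ∀ j →
                       Alternating (λ A → D (λ i → insertAt (A i) j 0#))
  insert-alternating alt j = record
    { D-cong      = λ A B A≋B → D-cong _ _ λ i → insert-cong (A i) (B i) (A≋B i)
    ; linear      = λ i x A B C Aᵢ same → linear i x _ _ _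
        (by-punchIn j
          (trans (at (A i)) (sym (trans (+-cong (trans (*-congˡ (at (B i))) (zeroʳ x)) (at (C i))) (+-identityʳ 0#))))
          (λ k → trans (off (A i) k) (trans (Aᵢ k) (sym (+-cong (*-congˡ (off (B i) k)) (off (C i) k))))))
        (λ k k≢i → insert-cong (A k) (B k) (proj₁ (same k k≢i)) , insert-cong (A k) (C k) (proj₂ (same k k≢i)))
    ; alternating = λ i k A i≢k eq → alternating i k _ i≢k (insert-cong (A i) (A k) eq)
    }
    where
    open Alternating alt
    at : ∀ r → insertAt r j 0# j ≈ 0#
    at r = reflexive (insertAt-lookup r j 0#)
    off : ∀ r k → insertAt r j 0# (punchIn j k) ≈ r k
    off r k = reflexive (insertAt-punchIn r j 0# k)
    insert-cong : ∀ r s → r ≋ s → insertAt r j 0# ≋ insertAt s j 0#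
    insert-cong r s r≋s = by-punchIn j (trans (at r) (sym (at s))) λ k → trans (off r k)
        (trans (r≋s k) (sym (off s k)))

  -- Expand the first row in unit vectors. Under the first row `𝟙 j`, column `j` of the other rows
  -- can be erased, and what remains is an alternating form in the minor, to which the induction
  -- applies. Its value at the identity is that of `D` at a row rotation of `𝟙`, which supplies the
  -- Laplace sign.
  alternating-unique : ∀ n {D : Matrix n n → Carrier} → Alternating D → ∀ A → D A ≈ det n A * D 𝟙
  alternating-unique zero    alt A = trans (Alternating.D-cong alt A 𝟙 λ ()) (sym (*-identityˡ _))
  alternating-unique (suc n) {D} alt A = begin
    D A
      ≈⟨ combine-first alt (A zero) 𝟙 A (λ c → sym (sum-𝟙ʳ (A zero) c)) ⟩
    sum (λ j → A zero j * D (𝟙 j ∷ tail A))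
      ≈⟨ sum-cong (λ j → A zero j * D (𝟙 j ∷ tail A)) (λ j → laplace A j * D 𝟙) term ⟩
    sum (λ j → laplace A j * D 𝟙)
      ≈⟨ *-distribʳ-sum (D 𝟙) (laplace A) ⟨
    det (suc n) A * D 𝟙 ∎
    where
    open Alternating alt
    erase : Fin (suc n) → Row (suc n) → Row (suc n)
    erase j r = insertAt (r ∘ punchIn j) j 0#
    -- Row `i` is `T i j` times `𝟙 j` plus its erased version; in the first summand `𝟙 j` occurs
    -- twice, as the top row and as row `i` of `V`.
    clear : ∀ j i T U → U i ≋ erase j (T i) → (∀ k → k ≢ i → T k ≋ U k) → D (𝟙 j ∷ T) ≈ D (𝟙 j ∷ U)
    clear j i T U eq same = begin
      D (𝟙 j ∷ T)
        ≈⟨ linear (suc i) (T i j) (𝟙 j ∷ T) (𝟙 j ∷ V) (𝟙 j ∷ U)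
             (by-punchIn j
               (sym (trans (+-cong (trans (*-congˡ (trans (Vᵢ j) (𝟙-diag j))) (*-identityʳ _))
                                   (trans (eq j) (reflexive (insertAt-lookup _ j 0#)))) (+-identityʳ _)))
               (λ k → sym (trans (+-cong (trans (*-congˡ (trans (Vᵢ _) (𝟙-off j k))) (zeroʳ _))
                                   (trans (eq _) (reflexive (insertAt-punchIn _ j 0# k)))) (+-identityˡ _))))
             (λ { zero _ → (λ _ → refl) , (λ _ → refl)
                ; (suc k) k≢i → V-other k (k≢i ∘ ≡.cong suc) , same k (k≢i ∘ ≡.cong suc) }) ⟩
      T i j * D (𝟙 j ∷ V) + D (𝟙 j ∷ U)
        ≈⟨ +-congʳ (trans (*-congˡ (alternating zero (suc i) (𝟙 j ∷ V) (λ ()) (λ c → sym (Vᵢ c)))) (zeroʳ _)) ⟩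
      0# + D (𝟙 j ∷ U)
        ≈⟨ +-identityˡ _ ⟩
      D (𝟙 j ∷ U) ∎
      where
      V : Matrix n (suc n)
      V k with k ≟ i
      ... | yes _ = 𝟙 j
      ... | no  _ = T k
      Vᵢ : V i ≋ 𝟙 j
      Vᵢ with i ≟ i
      ... | yes _   = λ _ → refl
      ... | no  i≢i = contradiction ≡.refl i≢i
      V-other : ∀ k → k ≢ i → T k ≋ V k
      V-other k k≢i with k ≟ i
      ... | yes k≡i = contradiction k≡i k≢i
      ... | no  _   = λ _ → refl
    term : ∀ j → A zero j * D (𝟙 j ∷ tail A) ≈ laplace A j * D 𝟙
    term j = begin
      A zero j * D (𝟙 j ∷ tail A)
        ≈⟨ *-congˡ (change-rows (λ T → D (𝟙 j ∷ T)) (erase j) (Alternating.D-cong (fix-first alt (𝟙 j)))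
            (clear j) (tail A)) ⟩
      A zero j * D (𝟙 j ∷ (λ i → insertAt (minor A j i) j 0#))
        ≈⟨ *-congˡ (alternating-unique n (insert-alternating (fix-first alt (𝟙 j)) j) (minor A j)) ⟩
      A zero j * (det n (minor A j) * D (𝟙 j ∷ (λ i → insertAt (𝟙 i) j 0#)))
        ≈⟨ *-congˡ (*-congˡ (trans (D-cong _ _ λ { zero _ → refl ; (suc i) → 𝟙-punchIn j i })
            (rotate-rows alt 𝟙 j))) ⟩
      A zero j * (det n (minor A j) * (sign (toℕ j) * D 𝟙))
        ≈⟨ solve 4 (λ a d s e → (a :* (d :* (s :* e))) := ((s :* (a :* d)) :* e)) refl (A zero j)
            (det n (minor A j)) (sign (toℕ j)) (D 𝟙) ⟩
      laplace A j * D 𝟙 ∎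

  -- Products, diagonal matrices and block sums

  ⊡-alternating : ∀ {n} (P : Matrix n n) → Alternating (λ A → det n (A ⊡ P))
  ⊡-alternating {n} P = record
    { D-cong      = λ A B A≋B → D-cong _ _ λ i k → cong (A i) (B i) (A≋B i) k
    ; linear      = λ i x A B C Aᵢ same → linear i x _ _ _
        (λ k → begin
          sum (λ j → A i j * P j k)
            ≈⟨ sum-cong (λ j → A i j * P j k) (λ j → x * (B i j * P j k) + C i j * P j k)
                 (λ j → trans (*-congʳ (Aᵢ j)) (trans (distribʳ _ _ _) (+-congʳ (*-assoc _ _ _)))) ⟩
          sum (λ j → x * (B i j * P j k) + C i j * P j k)
            ≈⟨ sum-linear x (λ j → B i j * P j k) (λ j → C i j * P j k) ⟩
          x * (B ⊡ P) i k + (C ⊡ P) i k ∎)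
        (λ k k≢i → cong (A k) (B k) (proj₁ (same k k≢i)) , cong (A k) (C k) (proj₂ (same k k≢i)))
    ; alternating = λ i k A i≢k eq → alternating i k _ i≢k (cong (A i) (A k) eq)
    }
    where
    open Alternating (det-isAlternating n)
    cong : ∀ u v → u ≋ v → ∀ k → sum (λ j → u j * P j k) ≈ sum (λ j → v j * P j k)
    cong u v u≋v k = sum-cong (λ j → u j * P j k) (λ j → v j * P j k) λ j → *-congʳ (u≋v j)

  -- For fixed `P` the left side is an alternating form in `A` whose value at the identity is
  -- `det n P`.
  det-⊡ : ∀ n (A P : Matrix n n) → det n (A ⊡ P) ≈ det n A * det n P
  det-⊡ n A P = trans (alternating-unique n (⊡-alternating P) A)
    (*-congˡ (det-cong n (𝟙 ⊡ P) P λ i k → sum-𝟙ˡ (λ j → P j k) i))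

  det-corner : ∀ n A → (∀ j → A zero (suc j) ≈ 0#) → det (suc n) A ≈ A zero zero * det n (minor A zero)
  det-corner n A A₀≈0 = trans
    (+-cong (*-identityˡ _) (sum-zero (λ j → laplace A (suc j)) λ j →
      trans (*-congˡ (trans (*-congʳ (A₀≈0 j)) (zeroˡ _))) (zeroʳ _)))
    (+-identityʳ _)

  opaque
    product : ∀ {n} → Row n → Carrier
    product {zero}  x = 1#
    product {suc n} x = x zero * product (x ∘ suc)

  opaque
    unfolding product

    product-cong : ∀ {n} (x y : Row n) → x ≋ y → product x ≈ product y
    product-cong {zero}  x y x≋y = refl
    product-cong {suc n} x y x≋y = *-cong (x≋y zero) (product-cong (x ∘ suc) (y ∘ suc) (x≋y ∘ suc))

  diagonal : ∀ {n} → Row n → Matrix n n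
  diagonal x i j = x i * 𝟙 i j

  opaque
    unfolding product

    det-diagonal : ∀ n x → det n (diagonal x) ≈ product x
    det-diagonal zero    x = refl
    det-diagonal (suc n) x = trans (det-corner n (diagonal x) λ j → zeroʳ _)
      (*-cong (*-identityʳ _) (det-diagonal n (x ∘ suc)))

  module _ {p q : ℕ} where

    block : Matrix p p → Matrix q q → Fin p ⊎ Fin q → Fin p ⊎ Fin q → Carrier
    block A C (inj₁ i) (inj₁ j) = A i j
    block A C (inj₁ i) (inj₂ j) = 0#
    block A C (inj₂ i) (inj₁ j) = 0#
    block A C (inj₂ i) (inj₂ j) = C i j

  infixr 5 _⊞_ _∥_
  _⊞_ : ∀ {p q} → Matrix p p → Matrix q q → Matrix (p ℕ.+ q) (p ℕ.+ q)
  _⊞_ {p} A C i j = block A C (splitAt p i) (splitAt p j)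

  det-𝟙⊞ : ∀ p q (C : Matrix q q) → det (p ℕ.+ q) (𝟙 {p} ⊞ C) ≈ det q C
  det-𝟙⊞ zero    q C = refl
  det-𝟙⊞ (suc p) q C = begin
    det (suc p ℕ.+ q) (𝟙 ⊞ C)
      ≈⟨ det-corner _ (𝟙 {suc p} ⊞ C) (λ j → off-corner (splitAt p j)) ⟩
    1# * det _ (minor (𝟙 {suc p} ⊞ C) zero)
      ≈⟨ *-identityˡ _ ⟩
    det _ (minor (𝟙 {suc p} ⊞ C) zero)
      ≈⟨ det-cong _ (minor (𝟙 {suc p} ⊞ C) zero) (𝟙 {p} ⊞ C) (λ i j → shrink (splitAt p i) (splitAt p j)) ⟩
    det _ (𝟙 {p} ⊞ C)
      ≈⟨ det-𝟙⊞ p q C ⟩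
    det q C ∎
    where
    off-corner : ∀ x → block (𝟙 {suc p}) C (inj₁ zero) (map₁ suc x) ≈ 0#
    off-corner (inj₁ j) = refl
    off-corner (inj₂ j) = refl
    shrink : ∀ x y → block (𝟙 {suc p}) C (map₁ suc x) (map₁ suc y) ≈ block (𝟙 {p}) C x y
    shrink (inj₁ i) (inj₁ j) = refl
    shrink (inj₁ i) (inj₂ j) = refl
    shrink (inj₂ i) (inj₁ j) = refl
    shrink (inj₂ i) (inj₂ j) = refl

  ⊞-alternating : ∀ {p q} (C : Matrix q q) → Alternating {p} {p} (λ A → det (p ℕ.+ q) (A ⊞ C))
  ⊞-alternating {p} {q} C = record
    { D-cong      = λ A B A≋B → D-cong (A ⊞ C) (B ⊞ C) λ i j → row-cong A B (splitAt p i) (λ { k _ → A≋B k })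
        (splitAt p j)
    ; linear      = λ i x A B E Aᵢ same → linear (i ↑ˡ q) x (A ⊞ C) (B ⊞ C) (E ⊞ C)
        (λ j → linear-row i x A B E Aᵢ (splitAt p (i ↑ˡ q)) (splitAt-↑ˡ p i q) (splitAt p j))
        (λ k k≢i → (λ j → row-cong A B (splitAt p k) (λ l eq → proj₁ (same l (avoid i k k≢i l eq))) (splitAt p j))
                 , (λ j → row-cong A E (splitAt p k) (λ l eq → proj₂ (same l (avoid i k k≢i l eq))) (splitAt p j)))
    ; alternating = λ i k A i≢k eq → alternating (i ↑ˡ q) (k ↑ˡ q) (A ⊞ C) (λ e → i≢k (↑ˡ-injective q i k e))
        (λ j → equal-row A i k eq (splitAt p (i ↑ˡ q)) (splitAt p (k ↑ˡ q)) (splitAt-↑ˡ p i q)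
            (splitAt-↑ˡ p k q) (splitAt p j))
    }
    where
    open Alternating (det-isAlternating (p ℕ.+ q))
    row-cong : ∀ A B x → (∀ l → x ≡ inj₁ l → A l ≋ B l) → ∀ y → block A C x y ≈ block B C x y
    row-cong A B (inj₁ i) eq (inj₁ j) = eq i ≡.refl j
    row-cong A B (inj₁ i) eq (inj₂ j) = refl
    row-cong A B (inj₂ i) eq (inj₁ j) = refl
    row-cong A B (inj₂ i) eq (inj₂ j) = refl
    linear-row : ∀ i x A B E → (∀ j → A i j ≈ x * B i j + E i j) → ∀ z → z ≡ inj₁ i → ∀ y →
                 block A C z y ≈ x * block B C z y + block E C z y
    linear-row i x A B E Aᵢ _ ≡.refl (inj₁ j) = Aᵢ j
    linear-row i x A B E Aᵢ _ ≡.refl (inj₂ j) = sym (trans (+-identityʳ _) (zeroʳ x))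
    equal-row : ∀ A i k → A i ≋ A k → ∀ x z → x ≡ inj₁ i → z ≡ inj₁ k → ∀ y → block A C x y ≈ block A C z y
    equal-row A i k eq _ _ ≡.refl ≡.refl (inj₁ j) = eq j
    equal-row A i k eq _ _ ≡.refl ≡.refl (inj₂ j) = refl
    avoid : ∀ i k → k ≢ i ↑ˡ q → ∀ l → splitAt p k ≡ inj₁ l → l ≢ i
    avoid i k k≢i l eq ≡.refl = k≢i (≡.sym (splitAt⁻¹-↑ˡ eq))

  -- Again uniqueness, in the variable `A`: only the case where `A` is the identity needs an
  -- expansion.
  det-⊞ : ∀ p q (A : Matrix p p) (C : Matrix q q) → det (p ℕ.+ q) (A ⊞ C) ≈ det p A * det q C
  det-⊞ p q A C = trans (alternating-unique p (⊞-alternating C) A) (*-congˡ (det-𝟙⊞ p q C))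

  _∥_ : ∀ {m p q} → Matrix m p → Matrix m q → Matrix m (p ℕ.+ q)
  _∥_ {p = p} P Q i j = [ P i , Q i ]′ (splitAt p j)

  sum-+ : ∀ p q (f : Row (p ℕ.+ q)) → sum f ≈ sum (λ i → f (i ↑ˡ q)) + sum (λ i → f (p ↑ʳ i))
  sum-+ zero    q f = sym (+-identityˡ _)
  sum-+ (suc p) q f = trans (+-congˡ (sum-+ p q (f ∘ suc))) (sym (+-assoc _ _ _))

  -- Lets an intertwiner be assembled from column blocks, one subrepresentation at a time.
  intertwine-∥ : ∀ {m p q} (M : Matrix m m) (P : Matrix m p) (Q : Matrix m q) A C →
                 (∀ i → (M ⊡ P) i ≋ (P ⊡ A) i) → (∀ i → (M ⊡ Q) i ≋ (Q ⊡ C) i) →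
                 ∀ i → (M ⊡ (P ∥ Q)) i ≋ ((P ∥ Q) ⊡ (A ⊞ C)) i
  intertwine-∥ {m} {p} {q} M P Q A C MP≋PA MQ≋QC i j = begin
    sum (λ k → M i k * [ P k , Q k ]′ (splitAt p j))
      ≈⟨ columns (splitAt p j) ⟩
    sum (λ k → P i k * block A C (inj₁ k) (splitAt p j)) + sum (λ k → Q i k * block A C (inj₂ k) (splitAt p j))
      ≈⟨ +-cong (sum-cong (λ k → P i k * block A C (inj₁ k) (splitAt p j))
          (λ k → (P ∥ Q) i (k ↑ˡ q) * (A ⊞ C) (k ↑ˡ q) j)
          (λ k → reflexive (≡.cong (λ x → [ P i , Q i ]′ x * block A C x (splitAt p j)) (≡.sym (splitAt-↑ˡ p k q)))))
                (sum-cong (λ k → Q i k * block A C (inj₂ k) (splitAt p j))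
                    (λ k → (P ∥ Q) i (p ↑ʳ k) * (A ⊞ C) (p ↑ʳ k) j)
                    (λ k → reflexive (≡.cong (λ x → [ P i , Q i ]′ x * block A C x (splitAt p j))
                    (≡.sym (splitAt-↑ʳ p q k))))) ⟩
    sum (λ k → (P ∥ Q) i (k ↑ˡ q) * (A ⊞ C) (k ↑ˡ q) j) + sum (λ k → (P ∥ Q) i (p ↑ʳ k) * (A ⊞ C) (p ↑ʳ k) j)
      ≈⟨ sum-+ p q (λ k → (P ∥ Q) i k * (A ⊞ C) k j) ⟨
    ((P ∥ Q) ⊡ (A ⊞ C)) i j ∎
    where
    columns : ∀ x → sum (λ k → M i k * [ P k , Q k ]′ x) ≈
              sum (λ k → P i k * block A C (inj₁ k) x) + sum (λ k → Q i k * block A C (inj₂ k) x)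
    columns (inj₁ j) = trans (MP≋PA i j)
      (sym (trans (+-congˡ (sum-zero (λ k → Q i k * 0#) λ k → zeroʳ _)) (+-identityʳ _)))
    columns (inj₂ j) = trans (MQ≋QC i j)
      (sym (trans (+-congʳ (sum-zero (λ k → P i k * 0#) λ k → zeroʳ _)) (+-identityˡ _)))

  -- An opaque copy: comparing two large determinants must not start expanding them.
  opaque
    Det : ∀ n → Matrix n n → Carrier
    Det = det

    Det-cong : ∀ n A B → (∀ i → A i ≋ B i) → Det n A ≈ Det n B
    Det-cong = det-cong

    Det-⊡ : ∀ n A B → Det n (A ⊡ B) ≈ Det n A * Det n B
    Det-⊡ = det-⊡

    Det-⊞ : ∀ p q (A : Matrix p p) (C : Matrix q q) → Det (p ℕ.+ q) (A ⊞ C) ≈ Det p A * Det q C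
    Det-⊞ = det-⊞

    Det-diagonal : ∀ n x → Det n (diagonal x) ≈ product x
    Det-diagonal = det-diagonal

-- Determinants under ring homomorphisms

module _ {a ℓ₁ b ℓ₂} (R : CommutativeRing a ℓ₁) (S : CommutativeRing b ℓ₂)
         {φ : CommutativeRing.Carrier R → CommutativeRing.Carrier S}
         (isHom : IsRingHomomorphism (CommutativeRing.rawRing R) (CommutativeRing.rawRing S) φ) where

  private
    module R = Determinant R
    module S = Determinant S
  open CommutativeRing S hiding (zero)
  open IsRingHomomorphism isHom

  hom-sum : ∀ {n} (f : R.Row n) → φ (R.sum f) ≈ S.sum (φ ∘ f)
  hom-sum {zero}  f = 0#-homo
  hom-sum {suc n} f = trans (+-homo _ _) (+-congˡ (hom-sum (f ∘ suc)))

  hom-sign : ∀ k → φ (R.sign k) ≈ S.sign k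
  hom-sign zero    = 1#-homo
  hom-sign (suc k) = trans (-‿homo _) (-‿cong (hom-sign k))

  hom-det : ∀ n A → φ (R.det n A) ≈ S.det n (λ i j → φ (A i j))
  hom-det zero    A = 1#-homo
  hom-det (suc n) A = trans (hom-sum (R.laplace A)) (S.sum-cong (φ ∘ R.laplace A) (S.laplace (λ i j → φ (A i j)))
    λ j → trans (*-homo _ _) (*-cong (hom-sign (toℕ j)) (trans (*-homo _ _) (*-congˡ (hom-det n (R.minor A j))))))

  opaque
    unfolding R.Det S.Det

    hom-Det : ∀ n A → φ (R.Det n A) ≈ S.Det n (λ i j → φ (A i j))
    hom-Det = hom-det

-- The Eisenstein integers ℤ[ω]

module Eisenstein where

  infix 8 _+_ω
  data 𝔼 : Set where
    _+_ω : ℤ → ℤ → 𝔼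

  re im : 𝔼 → ℤ
  re (a + b ω) = a
  im (a + b ω) = b

  infixl 6 _⊹_
  infixl 7 _⋆_
  _⊹_ _⋆_ : 𝔼 → 𝔼 → 𝔼
  (a + b ω) ⊹ (c + d ω) = (a Int.+ c) + (b Int.+ d) ω
  (a + b ω) ⋆ (c + d ω) = (a Int.* c Int.- b Int.* d) + (a Int.* d Int.+ b Int.* c Int.- b Int.* d) ω

  neg conj : 𝔼 → 𝔼
  neg  (a + b ω) = (Int.- a) + (Int.- b) ω
  conj (a + b ω) = (a Int.- b) + (Int.- b) ω

  ι : ℤ → 𝔼
  ι a = a + (+ 0) ω

  isCommutativeRing : IsCommutativeRing _≡_ _⊹_ _⋆_ neg (ι (+ 0)) (ι (+ 1))
  isCommutativeRing = record
    { isRing = record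
      { +-isAbelianGroup = record
        { isGroup = record
          { isMonoid = record
            { isSemigroup = record
              { isMagma = record { isEquivalence = ≡.isEquivalence ; ∙-cong = ≡.cong₂ _⊹_ }
              ; assoc = λ { (a + b ω) (c + d ω) (e + f ω) → ≡.cong₂ _+_ω (ℤₚ.+-assoc a c e) (ℤₚ.+-assoc b d f) } }
            ; identity = (λ { (a + b ω) → ≡.cong₂ _+_ω (ℤₚ.+-identityˡ a) (ℤₚ.+-identityˡ b) })
                       , (λ { (a + b ω) → ≡.cong₂ _+_ω (ℤₚ.+-identityʳ a) (ℤₚ.+-identityʳ b) }) }
          ; inverse = (λ { (a + b ω) → ≡.cong₂ _+_ω (ℤₚ.+-inverseˡ a) (ℤₚ.+-inverseˡ b) })
                    , (λ { (a + b ω) → ≡.cong₂ _+_ω (ℤₚ.+-inverseʳ a) (ℤₚ.+-inverseʳ b) })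
          ; ⁻¹-cong = ≡.cong neg }
        ; comm = λ { (a + b ω) (c + d ω) → ≡.cong₂ _+_ω (ℤₚ.+-comm a c) (ℤₚ.+-comm b d) } }
      ; *-cong = ≡.cong₂ _⋆_
      ; *-assoc = λ { (a + b ω) (c + d ω) (e + f ω) → ≡.cong₂ _+_ω (assoc-re a b c d e f) (assoc-im a b c d e f) }
      ; *-identity = (λ { (a + b ω) → ≡.cong₂ _+_ω (idˡ-re a b) (idˡ-im a b) })
                   , (λ { (a + b ω) → ≡.cong₂ _+_ω (idʳ-re a b) (idʳ-im a b) })
      ; distrib = (λ { (a + b ω) (c + d ω) (e + f ω) → ≡.cong₂ _+_ω (distˡ-re a b c d e f) (distˡ-im a b c d e f) })
                , (λ { (a + b ω) (c + d ω) (e + f ω) → ≡.cong₂ _+_ω (distʳ-re a b c d e f) (distʳ-im a b c d e f) }) }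
    ; *-comm = λ { (a + b ω) (c + d ω) → ≡.cong₂ _+_ω (comm-re a b c d) (comm-im a b c d) } }
    where
    open Int using (_+_; _*_; _-_; -_)
    assoc-re : ∀ a b c d e f → (a * c - b * d) * e - (a * d + b * c - b * d) * f ≡
                               a * (c * e - d * f) - b * (c * f + d * e - d * f)
    assoc-re = solve-∀
    assoc-im : ∀ a b c d e f → (a * c - b * d) * f + (a * d + b * c - b * d) * e - (a * d + b * c - b * d) * f ≡
                               a * (c * f + d * e - d * f) + b * (c * e - d * f) - b * (c * f + d * e - d * f)
    assoc-im = solve-∀
    idˡ-re : ∀ a b → + 1 * a - + 0 * b ≡ a
    idˡ-re = solve-∀
    idˡ-im : ∀ a b → + 1 * b + + 0 * a - + 0 * b ≡ b
    idˡ-im = solve-∀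
    idʳ-re : ∀ a b → a * + 1 - b * + 0 ≡ a
    idʳ-re = solve-∀
    idʳ-im : ∀ a b → a * + 0 + b * + 1 - b * + 0 ≡ b
    idʳ-im = solve-∀
    distˡ-re : ∀ a b c d e f → a * (c + e) - b * (d + f) ≡ a * c - b * d + (a * e - b * f)
    distˡ-re = solve-∀
    distˡ-im : ∀ a b c d e f → a * (d + f) + b * (c + e) - b * (d + f) ≡
                               a * d + b * c - b * d + (a * f + b * e - b * f)
    distˡ-im = solve-∀
    distʳ-re : ∀ a b c d e f → (c + e) * a - (d + f) * b ≡ c * a - d * b + (e * a - f * b)
    distʳ-re = solve-∀
    distʳ-im : ∀ a b c d e f → (c + e) * b + (d + f) * a - (d + f) * b ≡
                               c * b + d * a - d * b + (e * b + f * a - f * b)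
    distʳ-im = solve-∀
    comm-re : ∀ a b c d → a * c - b * d ≡ c * a - d * b
    comm-re = solve-∀
    comm-im : ∀ a b c d → a * d + b * c - b * d ≡ c * b + d * a - d * b
    comm-im = solve-∀

  𝔼-ring : CommutativeRing _ _
  𝔼-ring = record { isCommutativeRing = isCommutativeRing }

  infix 4 _≟ᴱ_
  _≟ᴱ_ : DecidableEquality 𝔼
  (a + b ω) ≟ᴱ (c + d ω) = map′ (λ { (≡.refl , ≡.refl) → ≡.refl }) (λ { ≡.refl → ≡.refl , ≡.refl })
      (a Int.≟ c ×-dec b Int.≟ d)

  module 𝔼-Solver = Algebra.Solver.Ring.Simple (fromCommutativeRing 𝔼-ring) _≟ᴱ_

  ι-isHom : IsRingHomomorphism (CommutativeRing.rawRing ℤₚ.+-*-commutativeRing) (CommutativeRing.rawRing 𝔼-ring) ι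
  ι-isHom = record
    { isSemiringHomomorphism = record
      { isNearSemiringHomomorphism = record
        { +-isMonoidHomomorphism = record
          { isMagmaHomomorphism = record { isRelHomomorphism = record { cong = ≡.cong ι } ; homo = λ a b → ≡.refl }
          ; ε-homo = ≡.refl }
        ; *-homo = λ a b → ≡.cong₂ _+_ω (mul-re a b) (mul-im a b) }
      ; 1#-homo = ≡.refl }
    ; -‿homo = λ a → ≡.refl }
    where
    open Int using (_+_; _*_; _-_; -_)
    mul-re : ∀ a b → a * b ≡ a * b - + 0 * + 0
    mul-re = solve-∀
    mul-im : ∀ a b → + 0 ≡ a * + 0 + + 0 * b - + 0 * + 0
    mul-im = solve-∀

  conj-isHom : IsRingHomomorphism (CommutativeRing.rawRing 𝔼-ring) (CommutativeRing.rawRing 𝔼-ring) conj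
  conj-isHom = record
    { isSemiringHomomorphism = record
      { isNearSemiringHomomorphism = record
        { +-isMonoidHomomorphism = record
          { isMagmaHomomorphism = record
            { isRelHomomorphism = record { cong = ≡.cong conj }
            ; homo = λ { (a + b ω) (c + d ω) → ≡.cong₂ _+_ω (add-re a b c d) (ℤₚ.neg-distrib-+ b d) } }
          ; ε-homo = ≡.refl }
        ; *-homo = λ { (a + b ω) (c + d ω) → ≡.cong₂ _+_ω (mul-re a b c d) (mul-im a b c d) } }
      ; 1#-homo = ≡.refl }
    ; -‿homo = λ { (a + b ω) → ≡.cong₂ _+_ω (neg-re a b) ≡.refl } }
    where
    open Int using (_+_; _*_; _-_; -_)
    add-re : ∀ a b c d → a + c - (b + d) ≡ a - b + (c - d)
    add-re = solve-∀
    mul-re : ∀ a b c d → a * c - b * d - (a * d + b * c - b * d) ≡ (a - b) * (c - d) - (- b) * (- d)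
    mul-re = solve-∀
    mul-im : ∀ a b c d → - (a * d + b * c - b * d) ≡ (a - b) * (- d) + (- b) * (c - d) - (- b) * (- d)
    mul-im = solve-∀
    neg-re : ∀ a b → - a - (- b) ≡ - (a - b)
    neg-re = solve-∀

open Eisenstein
open import Defs hiding (det)

-- Representations of H₃ and the block form of the group matrix

module Representations where

  module R = CommutativeRing 𝔼-ring
  open Determinant 𝔼-ring
  open Algebra.Properties.CommutativeSemigroup R.*-commutativeSemigroup using (x∙yz≈y∙xz; xy∙z≈xz∙y)
  open ≡.≡-Reasoning

  _≟ᴴ_ : DecidableEquality H₃
  _≟ᴴ_ = ≡-dec _≟_ (≡-dec _≟_ _≟_)

  index : H₃ → Fin 27
  index (a , b , c) = combine a (combine b c)

  index-enum : ∀ i → index (enum i) ≡ i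
  index-enum = from-yes (all? λ i → index (enum i) ≟ i)

  enum-index-· : ∀ i j → (enum (index (enum i · (enum j ⁻¹)))) ≡ (enum i · (enum j ⁻¹))
  enum-index-· = from-yes (all? λ i → all? λ j → enum (index (enum i · (enum j ⁻¹))) ≟ᴴ (enum i · (enum j ⁻¹)))

  ⁻¹-cancel : ∀ i j → (enum i · ((((enum i ⁻¹) · enum j) ⁻¹) ⁻¹)) ≡ enum j
  ⁻¹-cancel = from-yes (all? λ i → all? λ j → (enum i · ((((enum i ⁻¹) · enum j) ⁻¹) ⁻¹)) ≟ᴴ enum j)

  ζ : Fin 3 → 𝔼
  ζ zero             = (+ 1) + (+ 0) ω
  ζ (suc zero)       = (+ 0) + (+ 1) ω
  ζ (suc (suc zero)) = (Int.- (+ 1)) + (Int.- (+ 1)) ω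

  χ : H₃ → Row 9
  χ (a , b , c) x = ζ ((quotient {3} 3 x ⊗ a) ⊕ (remainder {3} 3 x ⊗ b))

  -- The Schrödinger representation: `x` shifts the basis cyclically, `y` acts as the diagonal
  -- matrix (1, ω, ω²) and `z` as the scalar ω.
  ρ : H₃ → Matrix 3 3
  ρ (a , b , c) l j = if does (l ≟ (j ⊕ a)) then ζ (c ⊕ (b ⊗ j)) else ι (+ 0)

  ρ-homo : ∀ i k l j → ρ ((enum i ⁻¹) · enum k) l j ≡ (ρ (enum i ⁻¹) ⊡ ρ (enum k)) l j
  ρ-homo = from-yes (all? λ i → all? λ k → all? λ l → all? λ j →
    ρ ((enum i ⁻¹) · enum k) l j ≟ᴱ (ρ (enum i ⁻¹) ⊡ ρ (enum k)) l j)

  χ-homo : ∀ i k x → χ ((enum i ⁻¹) · enum k) x ≡ χ (enum i ⁻¹) x ⋆ χ (enum k) x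
  χ-homo = from-yes (all? λ i → all? λ k → all? λ x →
    χ ((enum i ⁻¹) · enum k) x ≟ᴱ (χ (enum i ⁻¹) x ⋆ χ (enum k) x))

  ⁻¹-cancel′ : ∀ i j → ((enum i ⁻¹) · (enum i · (enum j ⁻¹))) ≡ (enum j ⁻¹)
  ⁻¹-cancel′ = from-yes (all? λ i → all? λ j → ((enum i ⁻¹) · (enum i · (enum j ⁻¹))) ≟ᴴ (enum j ⁻¹))

  ⁻¹-involutive : ∀ i → ((enum i ⁻¹) ⁻¹) ≡ enum i
  ⁻¹-involutive = from-yes (all? λ i → ((enum i ⁻¹) ⁻¹) ≟ᴴ enum i)

  enum-index : ∀ i j → enum (index (((enum i ⁻¹) · enum j) ⁻¹)) ≡ (((enum i ⁻¹) · enum j) ⁻¹)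
  enum-index = from-yes (all? λ i → all? λ j → enum (index (((enum i ⁻¹) · enum j) ⁻¹)) ≟ᴴ
      (((enum i ⁻¹) · enum j) ⁻¹))

  -- For fixed i, the change of variables k = g_i h⁻¹.
  quotients : Fin 27 → Permutation′ 27
  quotients i = permutation
    (λ h → index (enum i · (enum h ⁻¹)))
    (λ k → index (((enum i ⁻¹) · enum k) ⁻¹))
    (λ k → ≡.trans (≡.cong (λ g → index (enum i · (g ⁻¹))) (enum-index i k))
             (≡.trans (≡.cong index (⁻¹-cancel i k)) (index-enum k)))
    (λ h → ≡.trans (≡.cong (λ g → index (((enum i ⁻¹) · g) ⁻¹)) (enum-index-· i h))
             (≡.trans (≡.cong (λ g → index (g ⁻¹)) (⁻¹-cancel′ i h))
               (≡.trans (≡.cong index (⁻¹-involutive h)) (index-enum h))))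

  opaque
    form : Row 27 → (H₃ → ℤ) → 𝔼
    form w f = sum λ k → ι (f (enum k)) ⋆ w k

  hat : ∀ {d} → (H₃ → Matrix d d) → (H₃ → ℤ) → Matrix d d
  hat R f m l = form (λ k → R (enum k) m l) f

  groupMatrix : (H₃ → ℤ) → Matrix 27 27
  groupMatrix f i j = ι (f (enum i · (enum j ⁻¹)))

  opaque
    unfolding form

    -- `p` is a row of `R`. Substituting k = g_i h⁻¹ turns h⁻¹ into g_i⁻¹ k, and the homomorphism
    -- law splits off the factor that depends on g_i alone from the sum that defines `hat R f`.
    intertwine : ∀ {d} (p : H₃ → Row d) (R : H₃ → Matrix d d) →
                 (∀ i k l → p ((enum i ⁻¹) · enum k) l ≡ sum λ m → p (enum i ⁻¹) m ⋆ R (enum k) m l) →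
                 ∀ f i l → (groupMatrix f ⊡ (λ h → p (enum h ⁻¹))) i l ≡ ((λ h → p (enum h ⁻¹)) ⊡ hat R f) i l
    intertwine p R p-homo f i l = begin
      sum (λ h → ι (f (enum i · (enum h ⁻¹))) ⋆ p (enum h ⁻¹) l)
        ≡⟨ sum-cong (λ h → ι (f (enum i · (enum h ⁻¹))) ⋆ p (enum h ⁻¹) l) (summand ∘ (quotients i ⟨$⟩ʳ_))
            (λ h → ≡.cong₂ (λ g g′ → ι (f g) ⋆ p g′ l) (≡.sym (enum-index-· i h))
             (≡.trans (≡.sym (⁻¹-cancel′ i h)) (≡.cong ((enum i ⁻¹) ·_) (≡.sym (enum-index-· i h))))) ⟩
      sum (summand ∘ (quotients i ⟨$⟩ʳ_))
        ≡⟨ sum-permute summand (quotients i) ⟨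
      sum summand
        ≡⟨ sum-cong summand (λ k → sum λ m → ι (f (enum k)) ⋆ (p (enum i ⁻¹) m ⋆ R (enum k) m l))
            (λ k → ≡.trans (≡.cong (ι (f (enum k)) ⋆_) (p-homo i k l))
            (*-distribˡ-sum (ι (f (enum k))) λ m → p (enum i ⁻¹) m ⋆ R (enum k) m l)) ⟩
      sum (λ k → sum λ m → ι (f (enum k)) ⋆ (p (enum i ⁻¹) m ⋆ R (enum k) m l))
        ≡⟨ ∑-comm (λ k m → ι (f (enum k)) ⋆ (p (enum i ⁻¹) m ⋆ R (enum k) m l)) ⟩
      sum (λ m → sum λ k → ι (f (enum k)) ⋆ (p (enum i ⁻¹) m ⋆ R (enum k) m l))
        ≡⟨ sum-cong (λ m → sum λ k → ι (f (enum k)) ⋆ (p (enum i ⁻¹) m ⋆ R (enum k) m l))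
            (λ m → p (enum i ⁻¹) m ⋆ hat R f m l) (λ m → ≡.trans
             (sum-cong (λ k → ι (f (enum k)) ⋆ (p (enum i ⁻¹) m ⋆ R (enum k) m l))
                 (λ k → p (enum i ⁻¹) m ⋆ (ι (f (enum k)) ⋆ R (enum k) m l)) λ k → x∙yz≈y∙xz (ι (f (enum k)))
                 (p (enum i ⁻¹) m) (R (enum k) m l))
             (≡.sym (*-distribˡ-sum (p (enum i ⁻¹) m) λ k → ι (f (enum k)) ⋆ R (enum k) m l))) ⟩
      sum (λ m → p (enum i ⁻¹) m ⋆ hat R f m l) ∎
      where
      summand : Fin 27 → 𝔼
      summand k = ι (f (enum k)) ⋆ p ((enum i ⁻¹) · enum k) l

  ρ̄ : H₃ → Matrix 3 3
  ρ̄ g l j = conj (ρ g l j)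

  ρ̄-homo : ∀ i k l j → ρ̄ ((enum i ⁻¹) · enum k) l j ≡ (ρ̄ (enum i ⁻¹) ⊡ ρ̄ (enum k)) l j
  ρ̄-homo = from-yes (all? λ i → all? λ k → all? λ l → all? λ j →
    ρ̄ ((enum i ⁻¹) · enum k) l j ≟ᴱ (ρ̄ (enum i ⁻¹) ⊡ ρ̄ (enum k)) l j)

  -- For each fixed row `j` the matrix coefficients span one copy of the representation inside the
  -- regular one; the three values of `j` give its multiplicity.
  coefficients : (H₃ → Matrix 3 3) → Fin 3 → Matrix 27 3
  coefficients R j h = R (enum h ⁻¹) j

  characters : Matrix 27 9
  characters h = χ (enum h ⁻¹)

  isotypic : (H₃ → Matrix 3 3) → Matrix 27 9
  isotypic R = coefficients R zero ∥ coefficients R (suc zero) ∥ coefficients R (suc (suc zero))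

  P : Matrix 27 27
  P = characters ∥ isotypic ρ ∥ isotypic ρ̄

  dimension : Fin 27 → ℤ
  dimension x = [ (λ _ → + 1) , (λ _ → + 3) ]′ (splitAt 9 x)

  -- The representations being unitary, the left side is the sum over the irreducible ones of
  -- dimension times the trace at g_i⁻¹ g_j. That is the regular character, which is 27 at the
  -- identity and 0 elsewhere.
  schur : ∀ i j → sum (λ x → P i x ⋆ (ι (dimension x) ⋆ conj (P j x))) ≡ diagonal (λ _ → ι (+ 27)) i j
  schur = from-yes (all? λ i → all? λ j → sum (λ x → P i x ⋆ (ι (dimension x) ⋆ conj (P j x))) ≟ᴱ diagonal
      (λ _ → ι (+ 27)) i j)

  module ℤ-Det = Determinant ℤₚ.+-*-commutativeRing

  ∑≡sum : ∀ n f → ∑ n f ≡ ℤ-Det.sum f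
  ∑≡sum zero    f = ≡.refl
  ∑≡sum (suc n) f = ≡.cong (λ y → f zero Int.+ y) (∑≡sum n (f ∘ suc))

  sgn≡sign : ∀ k → sgn k ≡ ℤ-Det.sign k
  sgn≡sign zero    = ≡.refl
  sgn≡sign (suc k) = ≡.cong (λ y → Int.- y) (sgn≡sign k)

  det≡det : ∀ n A → Defs.det n A ≡ ℤ-Det.det n A
  det≡det zero    A = ≡.refl
  det≡det (suc n) A = ≡.trans (∑≡sum (suc n) term) (ℤ-Det.sum-cong term (ℤ-Det.laplace A) λ j →
    ≡.cong₂ Int._*_ (sgn≡sign (toℕ j)) (≡.cong (λ y → A zero j Int.* y) (det≡det n (ℤ-Det.minor A j))))
    where
    term : ℤ-Det.Row (suc n)
    term j = sgn (toℕ j) Int.* (A zero j Int.* Defs.det n (ℤ-Det.minor A j))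

  opaque
    unfolding ℤ-Det.Det

    det≡Det : ∀ n A → Defs.det n A ≡ ℤ-Det.Det n A
    det≡Det = det≡det

  ι-groupDet : ∀ f → ι (groupDet f) ≡ Det 27 (groupMatrix f)
  ι-groupDet f = ≡.trans (≡.cong ι (det≡Det 27 A)) (hom-Det ℤₚ.+-*-commutativeRing 𝔼-ring ι-isHom 27 A)
    where
    A : ℤ-Det.Matrix 27 27
    A i j = f (enum i · (enum j ⁻¹))

  χ̂ : (H₃ → ℤ) → Row 9
  χ̂ f x = form (λ k → χ (enum k) x) f

  thrice : Matrix 3 3 → Matrix 9 9
  thrice A = A ⊞ A ⊞ A

  blocks : (H₃ → ℤ) → Matrix 27 27
  blocks f = diagonal (χ̂ f) ⊞ thrice (hat ρ f) ⊞ thrice (hat ρ̄ f)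

  opaque
    unfolding form

    intertwine-χ : ∀ f i x → (groupMatrix f ⊡ characters) i x ≡ (characters ⊡ diagonal (χ̂ f)) i x
    intertwine-χ f i x = ≡.trans
      (intertwine χ (diagonal ∘ χ) homo f i x)
      (sum-cong (λ m → characters i m ⋆ hat (diagonal ∘ χ) f m x) (λ m → characters i m ⋆ diagonal (χ̂ f) m x)
        λ m → ≡.cong (characters i m ⋆_) (≡.trans
          (sum-cong (λ k → ι (f (enum k)) ⋆ (χ (enum k) m ⋆ 𝟙 m x)) (λ k → (ι (f (enum k)) ⋆ χ (enum k) m) ⋆ 𝟙 m x)
            λ k → ≡.sym (R.*-assoc (ι (f (enum k))) (χ (enum k) m) (𝟙 m x)))
          (≡.sym (*-distribʳ-sum (𝟙 m x) λ k → ι (f (enum k)) ⋆ χ (enum k) m))))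
      where
      homo : ∀ i k x → χ ((enum i ⁻¹) · enum k) x ≡ sum λ m → χ (enum i ⁻¹) m ⋆ (χ (enum k) m ⋆ 𝟙 m x)
      homo i k x = ≡.trans (χ-homo i k x) (≡.trans
        (≡.sym (sum-𝟙ʳ (λ m → χ (enum i ⁻¹) m ⋆ χ (enum k) m) x))
        (sum-cong (λ m → (χ (enum i ⁻¹) m ⋆ χ (enum k) m) ⋆ 𝟙 m x) (λ m → χ (enum i ⁻¹) m ⋆ (χ (enum k) m ⋆ 𝟙 m x))
          λ m → R.*-assoc (χ (enum i ⁻¹) m) (χ (enum k) m) (𝟙 m x)))

  intertwine-isotypic : ∀ R → (∀ i k l j → R ((enum i ⁻¹) · enum k) l j ≡ (R (enum i ⁻¹) ⊡ R (enum k)) l j) →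
                        ∀ f i l → (groupMatrix f ⊡ isotypic R) i l ≡ (isotypic R ⊡ thrice (hat R f)) i l
  intertwine-isotypic R R-homo f =
    intertwine-∥ M (coefficients R zero) (coefficients R (suc zero) ∥ coefficients R (suc (suc zero)))
      A (A ⊞ A) (row zero)
      (intertwine-∥ M (coefficients R (suc zero)) (coefficients R (suc (suc zero))) A A (row (suc zero))
          (row (suc (suc zero))))
    where
    M : Matrix 27 27
    M = groupMatrix f
    A : Matrix 3 3
    A = hat R f
    row : ∀ j i l → (M ⊡ coefficients R j) i l ≡ (coefficients R j ⊡ A) i l
    row j = intertwine (λ g → R g j) R (λ i k l → R-homo i k j l) f

  intertwine-P : ∀ f i x → (groupMatrix f ⊡ P) i x ≡ (P ⊡ blocks f) i x
  intertwine-P f =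
    intertwine-∥ (groupMatrix f) characters (isotypic ρ ∥ isotypic ρ̄)
      (diagonal (χ̂ f)) (thrice (hat ρ f) ⊞ thrice (hat ρ̄ f)) (intertwine-χ f)
      (intertwine-∥ (groupMatrix f) (isotypic ρ) (isotypic ρ̄) (thrice (hat ρ f)) (thrice (hat ρ̄ f))
        (intertwine-isotypic ρ ρ-homo f) (intertwine-isotypic ρ̄ ρ̄-homo f))

  ι-cancelˡ : ∀ m .{{_ : Int.NonZero m}} x y → ι m ⋆ x ≡ ι m ⋆ y → x ≡ y
  ι-cancelˡ m (a + b ω) (c + d ω) eq = ≡.cong₂ _+_ω
    (ℤₚ.*-cancelˡ-≡ m a c (≡.trans (scale-re m a b) (≡.trans (≡.cong re eq) (≡.sym (scale-re m c d)))))
    (ℤₚ.*-cancelˡ-≡ m b d (≡.trans (scale-im m a b) (≡.trans (≡.cong im eq) (≡.sym (scale-im m c d)))))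
    where
    open Int using (_+_; _*_; _-_)
    scale-re : ∀ m a b → m * a ≡ m * a - + 0 * b
    scale-re = solve-∀
    scale-im : ∀ m a b → m * b ≡ m * b + + 0 * a - + 0 * b
    scale-im = solve-∀

  P* : Matrix 27 27
  P* x j = ι (dimension x) ⋆ conj (P j x)

  opaque
    unfolding product

    product-const : ∀ n a → product {n} (λ _ → ι (+ a)) ≡ ι (+ (a ^ n))
    product-const zero    a = ≡.refl
    product-const (suc n) a = ≡.trans (≡.cong (ι (+ a) ⋆_) (product-const n a))
      (≡.trans (≡.sym (IsRingHomomorphism.*-homo ι-isHom (+ a) (+ (a ^ n)))) (≡.cong ι (≡.sym (ℤₚ.pos-* a (a ^ n)))))

  det-P-P* : Det 27 P ⋆ Det 27 P* ≡ ι (+ (27 ^ 27))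
  det-P-P* = begin
    Det 27 P ⋆ Det 27 P*                    ≡⟨ Det-⊡ 27 P P* ⟨
    Det 27 (P ⊡ P*)                         ≡⟨ Det-cong 27 (P ⊡ P*) (diagonal (λ _ → ι (+ 27))) schur ⟩
    Det 27 (diagonal {27} (λ _ → ι (+ 27)))      ≡⟨ Det-diagonal 27 (λ _ → ι (+ 27)) ⟩
    product {27} (λ _ → ι (+ 27))                ≡⟨ product-const 27 27 ⟩
    ι (+ (27 ^ 27))                       ∎

  det-conjugate : ∀ (A p q B : 𝔼) m .{{_ : Int.NonZero m}} → p ⋆ q ≡ ι m → A ⋆ p ≡ p ⋆ B → A ≡ B
  det-conjugate A p q B m pq≡m Ap≡pB = ι-cancelˡ m A B (begin
    ι m ⋆ A       ≡⟨ ≡.cong (_⋆ A) pq≡m ⟨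
    (p ⋆ q) ⋆ A   ≡⟨ R.*-comm (p ⋆ q) A ⟩
    A ⋆ (p ⋆ q)   ≡⟨ R.*-assoc A p q ⟨
    (A ⋆ p) ⋆ q   ≡⟨ ≡.cong (_⋆ q) Ap≡pB ⟩
    (p ⋆ B) ⋆ q   ≡⟨ xy∙z≈xz∙y p B q ⟩
    (p ⋆ q) ⋆ B   ≡⟨ ≡.cong (_⋆ B) pq≡m ⟩
    ι m ⋆ B       ∎)

  det-blocks : ∀ f → Det 27 (groupMatrix f) ≡ Det 27 (blocks f)
  det-blocks f = det-conjugate (Det 27 (groupMatrix f)) (Det 27 P) (Det 27 P*) (Det 27 (blocks f)) (+ (27 ^ 27))
      det-P-P*
    (≡.trans (≡.sym (Det-⊡ 27 (groupMatrix f) P))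
      (≡.trans (Det-cong 27 (groupMatrix f ⊡ P) (P ⊡ blocks f) (intertwine-P f)) (Det-⊡ 27 P (blocks f))))

  Δ : (H₃ → ℤ) → 𝔼
  Δ f = Det 3 (hat ρ f)

  conj-ι : ∀ a → conj (ι a) ≡ ι a
  conj-ι a = ≡.cong (_+ (+ 0) ω) (ℤₚ.+-identityʳ a)

  opaque
    unfolding form

    det-ρ̄ : ∀ f → Det 3 (hat ρ̄ f) ≡ conj (Δ f)
    det-ρ̄ f = ≡.sym (≡.trans (hom-Det 𝔼-ring 𝔼-ring conj-isHom 3 (hat ρ f))
        (Det-cong 3 (λ m l → conj (hat ρ f m l)) (hat ρ̄ f) λ m l →
      ≡.trans (hom-sum 𝔼-ring 𝔼-ring conj-isHom (λ k → ι (f (enum k)) ⋆ ρ (enum k) m l))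
        (sum-cong (λ k → conj (ι (f (enum k)) ⋆ ρ (enum k) m l)) (λ k → ι (f (enum k)) ⋆ ρ̄ (enum k) m l)
          λ k → ≡.trans (IsRingHomomorphism.*-homo conj-isHom (ι (f (enum k))) (ρ (enum k) m l))
              (≡.cong (_⋆ ρ̄ (enum k) m l) (conj-ι (f (enum k)))))))

  det-thrice : ∀ A → Det 9 (thrice A) ≡ Det 3 A ⋆ (Det 3 A ⋆ Det 3 A)
  det-thrice A = ≡.trans (Det-⊞ 3 6 A (A ⊞ A)) (≡.cong (Det 3 A ⋆_) (Det-⊞ 3 3 A A))

  groupDet-factors : ∀ f → ι (groupDet f) ≡
    product (χ̂ f) ⋆ ((Δ f ⋆ (Δ f ⋆ Δ f)) ⋆ (conj (Δ f) ⋆ (conj (Δ f) ⋆ conj (Δ f))))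
  groupDet-factors f = ≡.trans (ι-groupDet f) (≡.trans (det-blocks f)
    (≡.trans (Det-⊞ 9 18 (diagonal (χ̂ f)) (thrice (hat ρ f) ⊞ thrice (hat ρ̄ f)))
      (≡.cong₂ _⋆_ (Det-diagonal 9 (χ̂ f))
        (≡.trans (Det-⊞ 9 9 (thrice (hat ρ f)) (thrice (hat ρ̄ f)))
          (≡.cong₂ _⋆_ (det-thrice (hat ρ f))
            (≡.trans (det-thrice (hat ρ̄ f)) (≡.cong (λ x → x ⋆ (x ⋆ x)) (det-ρ̄ f))))))))

open Representations

-- Fibre sums and the explicit factors of the group determinant

module Invariants where

  open Determinant 𝔼-ring
  open Algebra.Properties.CommutativeSemigroup R.*-commutativeSemigroup using (x∙yz≈y∙xz)
  open Vector using (foldr; _∷_; [])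
  open ≡.≡-Reasoning
  open 𝔼-Solver using (solve; Polynomial; con; _:+_; _:*_; _:-_; :-_; _:=_)

  -- x^a y^b z^c has index 9a + 3b + c, so that column is 3a + b and depth is c.
  column : Fin 27 → Fin 9
  column k = quotient {9} 3 k

  depth : Fin 27 → Fin 3
  depth k = remainder {9} 3 k

  δ : Fin 9 → Fin 27 → ℤ
  δ t k = if does (column k ≟ t) then + 1 else + 0

  opaque
    unfolding form

    β : (H₃ → ℤ) → Fin 9 → ℤ
    β f t = ℤ-Det.sum λ k → f (enum k) Int.* δ t k

    ι-β : ∀ f t → ι (β f t) ≡ form (ι ∘ δ t) f
    ι-β f t = ≡.trans (hom-sum ℤₚ.+-*-commutativeRing 𝔼-ring ι-isHom (λ k → f (enum k) Int.* δ t k))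
      (sum-cong (λ k → ι (f (enum k) Int.* δ t k)) (λ k → ι (f (enum k)) ⋆ ι (δ t k))
        λ k → IsRingHomomorphism.*-homo ι-isHom (f (enum k)) (δ t k))

    -- Reduces an identity between linear forms in `f` to their weights, which a finite check
    -- settles.
    form-combination : ∀ {p} (c : Row p) (w : Matrix p 27) v f →
                       (∀ k → v k ≡ sum λ t → c t ⋆ w t k) → form v f ≡ sum λ t → c t ⋆ form (w t) f
    form-combination c w v f v≡cw = begin
      sum (λ k → ι (f (enum k)) ⋆ v k)
        ≡⟨ sum-cong (λ k → ι (f (enum k)) ⋆ v k) (λ k → sum λ t → ι (f (enum k)) ⋆ (c t ⋆ w t k))
             (λ k → ≡.trans (≡.cong (ι (f (enum k)) ⋆_) (v≡cw k))
                 (*-distribˡ-sum (ι (f (enum k))) λ t → c t ⋆ w t k)) ⟩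
      sum (λ k → sum λ t → ι (f (enum k)) ⋆ (c t ⋆ w t k))
        ≡⟨ ∑-comm (λ k t → ι (f (enum k)) ⋆ (c t ⋆ w t k)) ⟩
      sum (λ t → sum λ k → ι (f (enum k)) ⋆ (c t ⋆ w t k))
        ≡⟨ sum-cong (λ t → sum λ k → ι (f (enum k)) ⋆ (c t ⋆ w t k)) (λ t → c t ⋆ sum λ k → ι (f (enum k)) ⋆ w t k)
             (λ t → ≡.trans (sum-cong (λ k → ι (f (enum k)) ⋆ (c t ⋆ w t k))
                 (λ k → c t ⋆ (ι (f (enum k)) ⋆ w t k)) λ k → x∙yz≈y∙xz (ι (f (enum k))) (c t) (w t k))
                            (≡.sym (*-distribˡ-sum (c t) λ k → ι (f (enum k)) ⋆ w t k))) ⟩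
      sum (λ t → c t ⋆ sum λ k → ι (f (enum k)) ⋆ w t k) ∎

  -- The Fourier coefficient of `f` on a fibre of ⟨z⟩ at the character z ↦ ω; `β` is the one at the
  -- trivial character. As ω is 1 modulo ω - 1, the two agree modulo ω - 1, with difference quotient
  -- `v`.
  u : (H₃ → ℤ) → Fin 9 → 𝔼
  u f t = form (λ k → ζ (depth k) ⋆ ι (δ t k)) f

  -- (ζ c - 1) / (ω - 1)
  κ : Fin 3 → 𝔼
  κ 0F = (+ 0) + (+ 0) ω
  κ 1F = (+ 1) + (+ 0) ω
  κ 2F = (+ 1) + (+ 1) ω

  v : (H₃ → ℤ) → Fin 9 → 𝔼
  v f t = form (λ k → κ (depth k) ⋆ ι (δ t k)) f

  ω-1 : 𝔼
  ω-1 = (Int.- (+ 1)) + (+ 1) ω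

  u-congruence : ∀ f t → u f t ≡ ι (β f t) ⊹ ω-1 ⋆ v f t
  u-congruence f t = begin
    u f t
      ≡⟨ form-combination c w (λ k → ζ (depth k) ⋆ ι (δ t k)) f (weights t) ⟩
    ι (+ 1) ⋆ form (ι ∘ δ t) f ⊹ (ω-1 ⋆ v f t ⊹ ι (+ 0))
      ≡⟨ solve 2 (λ x y → con (ι (+ 1)) :* x :+ (y :+ con (ι (+ 0))) := x :+ y) ≡.refl (form (ι ∘ δ t) f)
          (ω-1 ⋆ v f t) ⟩
    form (ι ∘ δ t) f ⊹ ω-1 ⋆ v f t
      ≡⟨ ≡.cong (_⊹ ω-1 ⋆ v f t) (ι-β f t) ⟨
    ι (β f t) ⊹ ω-1 ⋆ v f t ∎
    where
    c : Row 2
    c 0F = ι (+ 1)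
    c 1F = ω-1
    w : Matrix 2 27
    w 0F k = ι (δ t k)
    w 1F k = κ (depth k) ⋆ ι (δ t k)
    weights : ∀ t k → ζ (depth k) ⋆ ι (δ t k) ≡ ι (+ 1) ⋆ ι (δ t k) ⊹ (ω-1 ⋆ (κ (depth k) ⋆ ι (δ t k)) ⊹ ι (+ 0))
    weights = from-yes (all? λ t → all? λ k → ζ (depth k) ⋆ ι (δ t k) ≟ᴱ
        (ι (+ 1) ⋆ ι (δ t k) ⊹ (ω-1 ⋆ (κ (depth k) ⋆ ι (δ t k)) ⊹ ι (+ 0))))

  character : Matrix 9 9
  character x t = ζ ((quotient {3} 3 x ⊗ quotient {3} 3 t) ⊕ (remainder {3} 3 x ⊗ remainder {3} 3 t))

  χ̂-expand : ∀ f x → χ̂ f x ≡ sum λ t → character x t ⋆ ι (β f t)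
  χ̂-expand f x = ≡.trans (form-combination (character x) (λ t k → ι (δ t k)) (λ k → χ (enum k) x) f (weights x))
    (sum-cong (λ t → character x t ⋆ form (ι ∘ δ t) f) (λ t → character x t ⋆ ι (β f t)) λ t → ≡.cong
        (character x t ⋆_) (≡.sym (ι-β f t)))
    where
    weights : ∀ x k → χ (enum k) x ≡ sum λ t → character x t ⋆ ι (δ t k)
    weights = from-yes (all? λ x → all? λ k → χ (enum k) x ≟ᴱ sum λ t → character x t ⋆ ι (δ t k))

  entry : Fin 3 → Fin 3 → Row 9
  entry l j t = if does (l ≟ (j ⊕ quotient {3} 3 t)) then ζ (remainder {3} 3 t ⊗ j) else ι (+ 0)

  ρ̂-expand : ∀ f l j → hat ρ f l j ≡ sum λ t → entry l j t ⋆ u f t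
  ρ̂-expand f l j = form-combination (entry l j) (λ t k → ζ (depth k) ⋆ ι (δ t k)) (λ k → ρ (enum k) l j) f
      (weights l j)
    where
    weights : ∀ l j k → ρ (enum k) l j ≡ sum λ t → entry l j t ⋆ (ζ (depth k) ⋆ ι (δ t k))
    weights = from-yes (all? λ l → all? λ j → all? λ k → ρ (enum k) l j ≟ᴱ sum λ t → entry l j t ⋆
        (ζ (depth k) ⋆ ι (δ t k)))

  -- Polynomials in nine variables placed at the points 3a + b of the affine plane over 𝔽₃. They are
  -- generic in the operations because the same expressions are read in ℤ, in ℤ[ω], in the syntax
  -- of the ring solvers and in residues.
  module Plane {A : Set} (_⊕_ _⊗_ _⊖_ : A → A → A) where

    private
      infixl 6 _+_ _-_
      infixl 7 _*_
      _+_ _*_ _-_ : A → A → A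
      _+_ = _⊕_
      _*_ = _⊗_
      _-_ = _⊖_

    e₂ norm : (p q r : A) → A
    e₂ p q r = p * q + q * r + r * p
    norm p q r = p * p + q * q + r * r - e₂ p q r

    cube : A → A
    cube x = x * x * x

    cubes : (a b c d e f g h i : A) → A
    cubes a b c d e f g h i =
      cube a + cube b + cube c + (cube d + cube e + cube f) + (cube g + cube h + cube i)

    total norm₁ norm₂ norm₃ norm₄ e₂₁ e₂₂ e₂₃ e₂₄ : (a b c d e f g h i : A) → A
    total a b c d e f g h i = (a + b + c) + (d + e + f) + (g + h + i)
    e₂₁ a b c d e f g h i = e₂ (a + b + c) (d + e + f) (g + h + i)
    e₂₂ a b c d e f g h i = e₂ (a + d + g) (b + e + h) (c + f + i)
    e₂₃ a b c d e f g h i = e₂ (a + e + i) (b + f + g) (c + d + h)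
    e₂₄ a b c d e f g h i = e₂ (a + f + h) (b + d + i) (c + e + g)
    norm₁ a b c d e f g h i = norm (a + b + c) (d + e + f) (g + h + i)
    norm₂ a b c d e f g h i = norm (a + d + g) (b + e + h) (c + f + i)
    norm₃ a b c d e f g h i = norm (a + e + i) (b + f + g) (c + d + h)
    norm₄ a b c d e f g h i = norm (a + f + h) (b + d + i) (c + e + g)

    -- The second, third and fourth elementary symmetric polynomials.
    E₂ E₃ E₄ : (a b c d e f g h i : A) → A
    E₂ a b c d e f g h i = e₂ (a + b + c) (d + e + f) (g + h + i) + (e₂ a b c + e₂ d e f + e₂ g h i)
    E₃ a b c d e f g h i =
      a * b * c + d * e * f + g * h * i + (a + b + c) * (d + e + f) * (g + h + i)
      + e₂ a b c * (d + e + f + (g + h + i)) + e₂ d e f * (a + b + c + (g + h + i)) + e₂ g h i *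
          (a + b + c + (d + e + f))
    E₄ a b c d e f g h i =
      e₂ (e₂ a b c) (e₂ d e f) (e₂ g h i)
      + a * b * c * (d + e + f + (g + h + i)) + d * e * f * (a + b + c + (g + h + i)) + g * h * i *
          (a + b + c + (d + e + f))
      + e₂ a b c * (d + e + f) * (g + h + i) + e₂ d e f * (a + b + c) * (g + h + i) + e₂ g h i * (a + b + c) *
          (d + e + f)

    -- The sum over the 4-subsets of the plane that contain no line.
    arcs : (a b c d e f g h i : A) → A
    arcs a b c d e f g h i = E₄ a b c d e f g h i - (
      l a b c + l d e f + l g h i + l a d g + l b e h + l c f i +
      l a e i + l b f g + l c d h + l a f h + l b d i + l c e g)
      where
      l : A → A → A → A
      l x y z = x * y * z * (total a b c d e f g h i - (x + y + z))

    σ₂ : (w x y z : A) → A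
    σ₂ w x y z = w * x + w * y + w * z + x * y + x * z + y * z

    -- The sum over the twelve lines of the products of their points; w and w′ are the weights of the
    -- lines a + b = const and b - a = const.
    lines : (w w′ a b c d e f g h i : A) → A
    lines w w′ a b c d e f g h i =
      (a * b * c + d * e * f + g * h * i) + (a * d * g + b * e * h + c * f * i)
      + w′ * (a * e * i + b * f * g + c * d * h) + w * (a * f * h + b * d * i + c * e * g)

  -- The determinant of ρ modulo 3(ω - 1)

  module 𝔼P = Plane _⊹_ _⋆_ (λ x y → x ⊹ neg y)
  module PP {n} = Plane {Polynomial n} _:+_ _:*_ _:-_

  -- The expansion of `det` replayed in solver syntax, so that its reading in ℤ[ω] unfolds to the
  -- determinant in `det-entry`.
  :det : ∀ {m} n → (Fin n → Fin n → Polynomial m) → Polynomial m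
  :det zero A = con (ι (+ 1))
  :det (suc n) A = foldr _:+_ (con (ι (+ 0))) λ j → :sign (toℕ j) :*
      (A zero j :* :det n (λ i k → A (suc i) (punchIn j k)))
    where
    :sign : ℕ → Polynomial _
    :sign zero = con (ι (+ 1))
    :sign (suc k) = :- :sign k

  ω ω² : 𝔼
  ω = ζ 1F
  ω² = ζ 2F

  opaque
    unfolding Det

    -- This shape is what makes the determinant computable modulo 3(ω - 1) from the variables modulo
    -- ω - 1: a cube gains the necessary precision by itself, and every other monomial is a product
    -- over a line and carries a factor 3.
    det-entry : ∀ a b c d e f g h i →
      Det 3 (λ l j → sum λ t → entry l j t ⋆ (a ∷ b ∷ c ∷ d ∷ e ∷ f ∷ g ∷ h ∷ i ∷ []) t) ≡
      𝔼P.cubes a b c d e f g h i ⊹ neg (ι (+ 3) ⋆ 𝔼P.lines ω ω² a b c d e f g h i)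
    det-entry = solve 9 (λ a b c d e f g h i →
      :det 3 (λ l j → foldr _:+_ (con (ι (+ 0))) λ t → con (entry l j t) :*
          (a ∷ b ∷ c ∷ d ∷ e ∷ f ∷ g ∷ h ∷ i ∷ []) t) :=
      PP.cubes a b c d e f g h i :- con (ι (+ 3)) :* PP.lines (con ω) (con ω²) a b c d e f g h i) ≡.refl

  -- The elements of ℤ[ω] with a chosen integer representative modulo m. They are closed under the
  -- ring operations, so a polynomial expression in them carries its own reduction modulo m.
  record Residue (m : 𝔼) : Set where
    constructor residue
    field
      element  : 𝔼
      integer  : ℤ
      multiple : 𝔼
      reduces  : element ≡ ι integer ⊹ m ⋆ multiple
  open Residue

  ι-⋆ : ∀ a b → ι (a Int.* b) ≡ ι a ⋆ ι b
  ι-⋆ = IsRingHomomorphism.*-homo ι-isHom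

  module _ {m : 𝔼} where

    infixl 6 _⊹ᵣ_ _⊖ᵣ_
    infixl 7 _⋆ᵣ_
    _⊹ᵣ_ _⊖ᵣ_ _⋆ᵣ_ : Residue m → Residue m → Residue m
    residue x a p x≡ ⊹ᵣ residue y b q y≡ = residue (x ⊹ y) (a Int.+ b) (p ⊹ q) (≡.trans (≡.cong₂ _⊹_ x≡ y≡)
      (solve 5 (λ a b p q m → (a :+ m :* p) :+ (b :+ m :* q) := (a :+ b) :+ m :* (p :+ q)) ≡.refl (ι a) (ι b) p q m))
    residue x a p x≡ ⊖ᵣ residue y b q y≡ = residue (x ⊹ neg y) (a Int.- b) (p ⊹ neg q)
        (≡.trans (≡.cong₂ (λ x y → x ⊹ neg y) x≡ y≡)
      (solve 5 (λ a b p q m → (a :+ m :* p) :- (b :+ m :* q) := (a :- b) :+ m :* (p :- q)) ≡.refl (ι a) (ι b) p q m))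
    residue x a p x≡ ⋆ᵣ residue y b q y≡ = residue (x ⋆ y) (a Int.* b) (ι a ⋆ q ⊹ ι b ⋆ p ⊹ m ⋆ p ⋆ q)
        (≡.trans (≡.cong₂ _⋆_ x≡ y≡)
      (≡.trans (solve 5 (λ a b p q m → (a :+ m :* p) :* (b :+ m :* q) := (a :* b) :+ m :*
          (a :* q :+ b :* p :+ m :* p :* q)) ≡.refl (ι a) (ι b) p q m)
        (≡.cong (_⊹ m ⋆ (ι a ⋆ q ⊹ ι b ⋆ p ⊹ m ⋆ p ⋆ q)) (≡.sym (ι-⋆ a b)))))

  thriceᵣ : Residue ω-1 → Residue (ι (+ 3) ⋆ ω-1)
  thriceᵣ (residue x a p x≡) = residue (ι (+ 3) ⋆ x) (+ 3 Int.* a) p (≡.trans (≡.cong (ι (+ 3) ⋆_) x≡)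
    (≡.trans (solve 2 (λ a p → con (ι (+ 3)) :* (a :+ con ω-1 :* p) := con (ι (+ 3)) :* a :+ con (ι (+ 3) ⋆ ω-1)
        :* p) ≡.refl (ι a) p)
      (≡.cong (_⊹ ι (+ 3) ⋆ ω-1 ⋆ p) (≡.sym (ι-⋆ (+ 3) a)))))

  -- (ω - 1)³ = 3 (ω - 1) (- ω).
  cubeᵣ : Residue ω-1 → Residue (ι (+ 3) ⋆ ω-1)
  cubeᵣ (residue x a p x≡) = residue (𝔼P.cube x) (a Int.* a Int.* a) q (≡.trans (≡.cong 𝔼P.cube x≡)
    (≡.trans (solve 2 (λ a p → PP.cube (a :+ con ω-1 :* p) :=
         PP.cube a :+ con (ι (+ 3) ⋆ ω-1) :* (a :* a :* p :+ con ω-1 :* a :* p :* p :- con ω :* PP.cube p))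
             ≡.refl (ι a) p)
      (≡.cong (_⊹ ι (+ 3) ⋆ ω-1 ⋆ q) (≡.sym (≡.trans (ι-⋆ (a Int.* a) a) (≡.cong (_⋆ ι a) (ι-⋆ a a)))))))
    where
    q : 𝔼
    q = ι a ⋆ ι a ⋆ p ⊹ ω-1 ⋆ ι a ⋆ p ⋆ p ⊹ neg (ω ⋆ 𝔼P.cube p)

  module ℤP = Plane Int._+_ Int._*_ Int._-_
  module ℛP {m} = Plane (_⊹ᵣ_ {m}) _⋆ᵣ_ _⊖ᵣ_

  -- Both line weights become 1 because ω and ω² are 1 modulo ω - 1.
  cubic : (a b c d e f g h i : ℤ) → ℤ
  cubic a b c d e f g h i = ℤP.cubes a b c d e f g h i Int.- + 3 Int.* ℤP.lines (+ 1) (+ 1) a b c d e f g h i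

  cubic-residue : (a b c d e f g h i : Residue ω-1) → Residue (ι (+ 3) ⋆ ω-1)
  cubic-residue a b c d e f g h i =
    (cubeᵣ a ⊹ᵣ cubeᵣ b ⊹ᵣ cubeᵣ c ⊹ᵣ (cubeᵣ d ⊹ᵣ cubeᵣ e ⊹ᵣ cubeᵣ f) ⊹ᵣ (cubeᵣ g ⊹ᵣ cubeᵣ h ⊹ᵣ cubeᵣ i))
    -- The quotients are those of ω - 1 and of ω² - 1 = (ω - 1)(ω + 1) by ω - 1.
    ⊖ᵣ thriceᵣ (ℛP.lines (residue ω (+ 1) (ι (+ 1)) ≡.refl) (residue ω² (+ 1) ((+ 1) + (+ 1) ω) ≡.refl) a b c d
        e f g h i)

  Δ-residue : ∀ f → ∃ λ q → Δ f ≡ ι (cubic (β f 0F) (β f 1F) (β f 2F) (β f 3F) (β f 4F) (β f 5F) (β f 6F)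
      (β f 7F) (β f 8F)) ⊹ ι (+ 3) ⋆ ω-1 ⋆ q
  Δ-residue f = multiple r , ≡.trans expand (reduces r)
    where
    uᵣ : Fin 9 → Residue ω-1
    uᵣ t = residue (u f t) (β f t) (v f t) (u-congruence f t)
    r : Residue (ι (+ 3) ⋆ ω-1)
    r = cubic-residue (uᵣ 0F) (uᵣ 1F) (uᵣ 2F) (uᵣ 3F) (uᵣ 4F) (uᵣ 5F) (uᵣ 6F) (uᵣ 7F) (uᵣ 8F)
    us : Fin 9 → 𝔼
    us = u f 0F ∷ u f 1F ∷ u f 2F ∷ u f 3F ∷ u f 4F ∷ u f 5F ∷ u f 6F ∷ u f 7F ∷ u f 8F ∷ []
    us≡u : ∀ t → u f t ≡ us t
    us≡u 0F = ≡.refl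
    us≡u 1F = ≡.refl
    us≡u 2F = ≡.refl
    us≡u 3F = ≡.refl
    us≡u 4F = ≡.refl
    us≡u 5F = ≡.refl
    us≡u 6F = ≡.refl
    us≡u 7F = ≡.refl
    us≡u 8F = ≡.refl
    expand : Δ f ≡ element r
    expand = ≡.trans
      (Det-cong 3 (hat ρ f) (λ l j → sum λ t → entry l j t ⋆ us t) λ l j → ≡.trans (ρ̂-expand f l j)
        (sum-cong (λ t → entry l j t ⋆ u f t) (λ t → entry l j t ⋆ us t) λ t → ≡.cong (entry l j t ⋆_) (us≡u t)))
      (det-entry (u f 0F) (u f 1F) (u f 2F) (u f 3F) (u f 4F) (u f 5F) (u f 6F) (u f 7F) (u f 8F))

  -- The product of the nine linear characters

  row₉ : ∀ {A : Set} (a b c d e f g h i : A) → Fin 9 → A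
  row₉ a b c d e f g h i = a ∷ b ∷ c ∷ d ∷ e ∷ f ∷ g ∷ h ∷ i ∷ []

  characterSum : (a b c d e f g h i : 𝔼) → Row 9
  characterSum a b c d e f g h i x = sum λ t → character x t ⋆ row₉ a b c d e f g h i t

  :characterSum : (a b c d e f g h i : Polynomial 9) → Fin 9 → Polynomial 9
  :characterSum a b c d e f g h i x =
    foldr _:+_ (con (ι (+ 0))) λ t → con (character x t) :* row₉ a b c d e f g h i t

  trivial-sum : ∀ a b c d e f g h i → characterSum a b c d e f g h i 0F ≡ 𝔼P.total a b c d e f g h i
  trivial-sum = solve 9 (λ a b c d e f g h i →
    :characterSum a b c d e f g h i 0F := PP.total a b c d e f g h i) ≡.refl

  -- Index 3p + q stands for the character (a, b) ↦ ω^(pa + qb). Negating p and q modulo 3 gives the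
  -- conjugate, so the nontrivial indices pair up as 3 and 6, 1 and 2, 5 and 7, 4 and 8.
  conjugate-pair₁ : ∀ a b c d e f g h i →
    characterSum a b c d e f g h i 3F ⋆ characterSum a b c d e f g h i 6F ≡ 𝔼P.norm₁ a b c d e f g h i
  conjugate-pair₁ = solve 9 (λ a b c d e f g h i →
    :characterSum a b c d e f g h i 3F :* :characterSum a b c d e f g h i 6F := PP.norm₁ a b c d e f g h i) ≡.refl

  conjugate-pair₂ : ∀ a b c d e f g h i →
    characterSum a b c d e f g h i 1F ⋆ characterSum a b c d e f g h i 2F ≡ 𝔼P.norm₂ a b c d e f g h i
  conjugate-pair₂ = solve 9 (λ a b c d e f g h i →
    :characterSum a b c d e f g h i 1F :* :characterSum a b c d e f g h i 2F := PP.norm₂ a b c d e f g h i) ≡.refl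

  conjugate-pair₃ : ∀ a b c d e f g h i →
    characterSum a b c d e f g h i 5F ⋆ characterSum a b c d e f g h i 7F ≡ 𝔼P.norm₃ a b c d e f g h i
  conjugate-pair₃ = solve 9 (λ a b c d e f g h i →
    :characterSum a b c d e f g h i 5F :* :characterSum a b c d e f g h i 7F := PP.norm₃ a b c d e f g h i) ≡.refl

  conjugate-pair₄ : ∀ a b c d e f g h i →
    characterSum a b c d e f g h i 4F ⋆ characterSum a b c d e f g h i 8F ≡ 𝔼P.norm₄ a b c d e f g h i
  conjugate-pair₄ = solve 9 (λ a b c d e f g h i →
    :characterSum a b c d e f g h i 4F :* :characterSum a b c d e f g h i 8F := PP.norm₄ a b c d e f g h i) ≡.refl

  opaque
    unfolding product

    product-pairs : ∀ (x : Row 9) → product x ≡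
      x 0F ⋆ ((x 3F ⋆ x 6F) ⋆ ((x 1F ⋆ x 2F) ⋆ ((x 5F ⋆ x 7F) ⋆ (x 4F ⋆ x 8F))))
    product-pairs x = solve 9 (λ a b c d e f g h i →
      a :* (b :* (c :* (d :* (e :* (f :* (g :* (h :* (i :* con (ι (+ 1)))))))))) :=
      a :* ((d :* g) :* ((b :* c) :* ((f :* h) :* (e :* i))))) ≡.refl
      (x 0F) (x 1F) (x 2F) (x 3F) (x 4F) (x 5F) (x 6F) (x 7F) (x 8F)

  -- With modulus 0 a residue is an equality: evaluating a polynomial at `lift`s then shows that `ι`
  -- commutes with that polynomial.
  exact : (r : Residue (ι (+ 0))) → element r ≡ ι (integer r)
  exact (residue x a q x≡) = ≡.trans x≡ (solve 2 (λ a q → a :+ con (ι (+ 0)) :* q := a) ≡.refl (ι a) q)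

  lift : ℤ → Residue (ι (+ 0))
  lift a = residue (ι a) a (ι (+ 0)) (solve 1 (λ a → a := a :+ con (ι (+ 0)) :* con (ι (+ 0))) ≡.refl (ι a))

  linear : (a b c d e f g h i : ℤ) → ℤ
  linear a b c d e f g h i = ℤP.total a b c d e f g h i Int.* (ℤP.norm₁ a b c d e f g h i Int.*
    (ℤP.norm₂ a b c d e f g h i Int.* (ℤP.norm₃ a b c d e f g h i Int.* ℤP.norm₄ a b c d e f g h i)))

  characters-product : ∀ a b c d e f g h i →
    product (characterSum (ι a) (ι b) (ι c) (ι d) (ι e) (ι f) (ι g) (ι h) (ι i)) ≡ ι (linear a b c d e f g h i)
  characters-product a b c d e f g h i = ≡.trans
    (product-pairs (characterSum (ι a) (ι b) (ι c) (ι d) (ι e) (ι f) (ι g) (ι h) (ι i)))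
    (≡.trans
      (≡.cong₂ _⋆_ (trivial-sum (ι a) (ι b) (ι c) (ι d) (ι e) (ι f) (ι g) (ι h) (ι i))
      (≡.cong₂ _⋆_ (conjugate-pair₁ (ι a) (ι b) (ι c) (ι d) (ι e) (ι f) (ι g) (ι h) (ι i))
      (≡.cong₂ _⋆_ (conjugate-pair₂ (ι a) (ι b) (ι c) (ι d) (ι e) (ι f) (ι g) (ι h) (ι i))
      (≡.cong₂ _⋆_ (conjugate-pair₃ (ι a) (ι b) (ι c) (ι d) (ι e) (ι f) (ι g) (ι h) (ι i))
                   (conjugate-pair₄ (ι a) (ι b) (ι c) (ι d) (ι e) (ι f) (ι g) (ι h) (ι i))))))
      (exact (value (lift a) (lift b) (lift c) (lift d) (lift e) (lift f) (lift g) (lift h) (lift i))))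
    where
    value : (a b c d e f g h i : Residue (ι (+ 0))) → Residue (ι (+ 0))
    value a b c d e f g h i = ℛP.total a b c d e f g h i ⋆ᵣ (ℛP.norm₁ a b c d e f g h i ⋆ᵣ
      (ℛP.norm₂ a b c d e f g h i ⋆ᵣ (ℛP.norm₃ a b c d e f g h i ⋆ᵣ ℛP.norm₄ a b c d e f g h i)))

  nrm : 𝔼 → ℤ
  nrm (x + y ω) = x Int.* x Int.- x Int.* y Int.+ y Int.* y

  ⋆-conj : ∀ z → z ⋆ conj z ≡ ι (nrm z)
  ⋆-conj (x + y ω) = ≡.cong₂ _+_ω (real x y) (imaginary x y)
    where
    open Int using (_+_; _*_; _-_; -_)
    real : ∀ x y → x * (x - y) - y * (- y) ≡ x * x - x * y + y * y
    real = solve-∀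
    imaginary : ∀ x y → x * (- y) + y * (x - y) - y * (- y) ≡ + 0
    imaginary = solve-∀

  cubes-product : ∀ z → (z ⋆ (z ⋆ z)) ⋆ (conj z ⋆ (conj z ⋆ conj z)) ≡ ι (nrm z Int.* (nrm z Int.* nrm z))
  cubes-product z = begin
    (z ⋆ (z ⋆ z)) ⋆ (conj z ⋆ (conj z ⋆ conj z))
      ≡⟨ solve 2 (λ z w → (z :* (z :* z)) :* (w :* (w :* w)) := (z :* w) :* ((z :* w) :* (z :* w))) ≡.refl z
          (conj z) ⟩
    (z ⋆ conj z) ⋆ ((z ⋆ conj z) ⋆ (z ⋆ conj z))
      ≡⟨ ≡.cong (λ n → n ⋆ (n ⋆ n)) (⋆-conj z) ⟩
    ι (nrm z) ⋆ (ι (nrm z) ⋆ ι (nrm z))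
      ≡⟨ exact (lift (nrm z) ⋆ᵣ (lift (nrm z) ⋆ᵣ lift (nrm z))) ⟩
    ι (nrm z Int.* (nrm z Int.* nrm z)) ∎

  linear-β : (H₃ → ℤ) → ℤ
  linear-β f = linear (β f 0F) (β f 1F) (β f 2F) (β f 3F) (β f 4F) (β f 5F) (β f 6F) (β f 7F) (β f 8F)

  χ̂-product : ∀ f → product (χ̂ f) ≡ ι (linear-β f)
  χ̂-product f = ≡.trans (product-cong (χ̂ f) (characterSum (ι (β f 0F)) (ι (β f 1F)) (ι (β f 2F)) (ι (β f 3F))
      (ι (β f 4F)) (ι (β f 5F)) (ι (β f 6F)) (ι (β f 7F)) (ι (β f 8F)))
      λ x → ≡.trans (χ̂-expand f x) (sum-cong (λ t → character x t ⋆ ι (β f t))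
          (λ t → character x t ⋆ row₉ (ι (β f 0F)) (ι (β f 1F)) (ι (β f 2F)) (ι (β f 3F)) (ι (β f 4F))
          (ι (β f 5F)) (ι (β f 6F)) (ι (β f 7F)) (ι (β f 8F)) t) λ t → ≡.cong (character x t ⋆_) (row t)))
    (characters-product (β f 0F) (β f 1F) (β f 2F) (β f 3F) (β f 4F) (β f 5F) (β f 6F) (β f 7F) (β f 8F))
    where
    row : ∀ t → ι (β f t) ≡ row₉ (ι (β f 0F)) (ι (β f 1F)) (ι (β f 2F)) (ι (β f 3F)) (ι (β f 4F)) (ι (β f 5F))
        (ι (β f 6F)) (ι (β f 7F)) (ι (β f 8F)) t
    row 0F = ≡.refl
    row 1F = ≡.refl
    row 2F = ≡.refl
    row 3F = ≡.refl
    row 4F = ≡.refl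
    row 5F = ≡.refl
    row 6F = ≡.refl
    row 7F = ≡.refl
    row 8F = ≡.refl

  groupDet-value : ∀ f → groupDet f ≡ linear-β f Int.* (nrm (Δ f) Int.* (nrm (Δ f) Int.* nrm (Δ f)))
  groupDet-value f = ≡.cong re (begin
    ι (groupDet f)
      ≡⟨ groupDet-factors f ⟩
    product (χ̂ f) ⋆ ((Δ f ⋆ (Δ f ⋆ Δ f)) ⋆ (conj (Δ f) ⋆ (conj (Δ f) ⋆ conj (Δ f))))
      ≡⟨ ≡.cong₂ _⋆_ (χ̂-product f) (cubes-product (Δ f)) ⟩
    ι (linear-β f) ⋆ ι (nrm (Δ f) Int.* (nrm (Δ f) Int.* nrm (Δ f)))
      ≡⟨ ι-⋆ (linear-β f) (nrm (Δ f) Int.* (nrm (Δ f) Int.* nrm (Δ f))) ⟨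
    ι (linear-β f Int.* (nrm (Δ f) Int.* (nrm (Δ f) Int.* nrm (Δ f)))) ∎)

open Invariants
open import Data.Integer using (_+_; _*_; _-_; -_)

-- Symmetric function identities and the expansion modulo 27

module Residues where

  open Data.Integer.Solver.+-*-Solver using (solve; Polynomial; con; _:+_; _:*_; _:-_; _:=_)
  module ZP {n} = Plane {Polynomial n} _:+_ _:*_ _:-_
  open ℤP

  -- Two distinct points lie on a common line in one parallel class and on different lines in the
  -- other three, so each product of two variables is counted three times.
  e₂-sum : ∀ a b c d e f g h i →
    e₂₁ a b c d e f g h i + e₂₂ a b c d e f g h i + e₂₃ a b c d e f g h i + e₂₄ a b c d e f g h i ≡
    + 3 * E₂ a b c d e f g h i
  e₂-sum = solve 9 (λ a b c d e f g h i →
    ZP.e₂₁ a b c d e f g h i :+ ZP.e₂₂ a b c d e f g h i :+ ZP.e₂₃ a b c d e f g h i :+ ZP.e₂₄ a b c d e f g h i :=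
    con (+ 3) :* ZP.E₂ a b c d e f g h i) ≡.refl

  -- `E₃ - lines` is the sum over the non-collinear triples. The congruence modulo 3 is stated with
  -- its exact quotient, which is where `arcs` enters, so that it is a polynomial identity.
  e₂-pairs : ∀ a b c d e f g h i →
    σ₂ (e₂₁ a b c d e f g h i) (e₂₂ a b c d e f g h i) (e₂₃ a b c d e f g h i) (e₂₄ a b c d e f g h i) ≡
    total a b c d e f g h i * (E₃ a b c d e f g h i - lines (+ 1) (+ 1) a b c d e f g h i)
    + + 3 * (E₂ a b c d e f g h i * E₂ a b c d e f g h i - arcs a b c d e f g h i)
  e₂-pairs = solve 9 (λ a b c d e f g h i →
    ZP.σ₂ (ZP.e₂₁ a b c d e f g h i) (ZP.e₂₂ a b c d e f g h i) (ZP.e₂₃ a b c d e f g h i)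
        (ZP.e₂₄ a b c d e f g h i) :=
    ZP.total a b c d e f g h i :* (ZP.E₃ a b c d e f g h i :- ZP.lines (con (+ 1)) (con (+ 1)) a b c d e f g h i)
    :+ con (+ 3) :* (ZP.E₂ a b c d e f g h i :* ZP.E₂ a b c d e f g h i :- ZP.arcs a b c d e f g h i)) ≡.refl

  -- Newton's identity for the third power sum, s³ - 3sE₂ + 3E₃.
  cubic-value : ∀ a b c d e f g h i → cubic a b c d e f g h i ≡
    cube (total a b c d e f g h i) + + 3 * (E₃ a b c d e f g h i - lines (+ 1) (+ 1) a b c d e f g h i
                                            - total a b c d e f g h i * E₂ a b c d e f g h i)
  cubic-value = solve 9 (λ a b c d e f g h i →
    ZP.cubes a b c d e f g h i :- con (+ 3) :* ZP.lines (con (+ 1)) (con (+ 1)) a b c d e f g h i :=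
    ZP.cube (ZP.total a b c d e f g h i) :+ con (+ 3) :*
        (ZP.E₃ a b c d e f g h i :- ZP.lines (con (+ 1)) (con (+ 1)) a b c d e f g h i
                                            :- ZP.total a b c d e f g h i :* ZP.E₂ a b c d e f g h i)) ≡.refl

  norm₁-value : ∀ a b c d e f g h i → norm₁ a b c d e f g h i ≡ total a b c d e f g h i * total a b c d e f g h
      i - + 3 * e₂₁ a b c d e f g h i
  norm₁-value = solve 9 (λ a b c d e f g h i → ZP.norm₁ a b c d e f g h i := ZP.total a b c d e f g h i :*
      ZP.total a b c d e f g h i :- con (+ 3) :* ZP.e₂₁ a b c d e f g h i) ≡.refl

  norm₂-value : ∀ a b c d e f g h i → norm₂ a b c d e f g h i ≡ total a b c d e f g h i * total a b c d e f g h
      i - + 3 * e₂₂ a b c d e f g h i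
  norm₂-value = solve 9 (λ a b c d e f g h i → ZP.norm₂ a b c d e f g h i := ZP.total a b c d e f g h i :*
      ZP.total a b c d e f g h i :- con (+ 3) :* ZP.e₂₂ a b c d e f g h i) ≡.refl

  norm₃-value : ∀ a b c d e f g h i → norm₃ a b c d e f g h i ≡ total a b c d e f g h i * total a b c d e f g h
      i - + 3 * e₂₃ a b c d e f g h i
  norm₃-value = solve 9 (λ a b c d e f g h i → ZP.norm₃ a b c d e f g h i := ZP.total a b c d e f g h i :*
      ZP.total a b c d e f g h i :- con (+ 3) :* ZP.e₂₃ a b c d e f g h i) ≡.refl

  norm₄-value : ∀ a b c d e f g h i → norm₄ a b c d e f g h i ≡ total a b c d e f g h i * total a b c d e f g h
      i - + 3 * e₂₄ a b c d e f g h i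
  norm₄-value = solve 9 (λ a b c d e f g h i → ZP.norm₄ a b c d e f g h i := ZP.total a b c d e f g h i :*
      ZP.total a b c d e f g h i :- con (+ 3) :* ZP.e₂₄ a b c d e f g h i) ≡.refl

  e₂-product : ∀ s w x y z → ∃ λ A →
    s * ((s * s - + 3 * w) * ((s * s - + 3 * x) * ((s * s - + 3 * y) * (s * s - + 3 * z)))) ≡
    cube (cube s) - + 3 * (s * cube s * cube s * (w + x + y + z)) + + 9 * (s * s * cube s * σ₂ w x y z) + + 27 * A
  e₂-product s w x y z = _ , solve 5 (λ s w x y z →
    s :* ((s :* s :- con (+ 3) :* w) :* ((s :* s :- con (+ 3) :* x) :*
        ((s :* s :- con (+ 3) :* y) :* (s :* s :- con (+ 3) :* z)))) :=
    ZP.cube (ZP.cube s) :- con (+ 3) :* (s :* ZP.cube s :* ZP.cube s :* (w :+ x :+ y :+ z)) :+ con (+ 9) :*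
        (s :* s :* ZP.cube s :* ZP.σ₂ w x y z)
    :+ con (+ 27) :* (con (+ 3) :* (s :* (w :* x :* y :* z)) :- ZP.cube s :*
        (w :* x :* y :+ w :* x :* z :+ w :* y :* z :+ x :* y :* z))) ≡.refl s w x y z

  substitute-symmetric : ∀ s E K F A →
    cube (cube s) - + 3 * (s * cube s * cube s * (+ 3 * E)) + + 9 * (s * s * cube s * (s * K + + 3 * F)) + + 27 * A ≡
    cube (cube s) + + 9 * (cube s * cube s * (K - s * E)) + + 27 * (s * s * cube s * F + A)
  substitute-symmetric = solve 5 (λ s E K F A →
    ZP.cube (ZP.cube s) :- con (+ 3) :* (s :* ZP.cube s :* ZP.cube s :* (con (+ 3) :* E)) :+ con (+ 9) :*
        (s :* s :* ZP.cube s :* (s :* K :+ con (+ 3) :* F)) :+ con (+ 27) :* A :=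
    ZP.cube (ZP.cube s) :+ con (+ 9) :* (ZP.cube s :* ZP.cube s :* (K :- s :* E)) :+ con (+ 27) :*
        (s :* s :* ZP.cube s :* F :+ A)) ≡.refl

  -- Cubing turns the error 9Y into a multiple of 27, so the norm is needed only modulo 9. In (t +
  -- 3Z)⁶ the term 18t⁵Z is the only correction to t⁶ modulo 27.
  nrm-cube : ∀ t Z Y → let X = t + + 3 * Z ; N = X * X + + 9 * Y in ∃ λ B →
    N * (N * N) ≡ cube t * cube t + + 18 * (cube t * t * t * Z) + + 27 * B
  nrm-cube t Z Y = _ , solve 3 (λ t Z Y → let X = t :+ con (+ 3) :* Z ; N = X :* X :+ con (+ 9) :* Y in
    N :* (N :* N) := ZP.cube t :* ZP.cube t :+ con (+ 18) :* (ZP.cube t :* t :* t :* Z) :+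
      con (+ 27) :* (con (+ 5) :* (t :* t :* t :* t :* Z :* Z) :+ con (+ 20) :* (ZP.cube t :* ZP.cube Z) :+ con
          (+ 45) :* (t :* t :* Z :* ZP.cube Z) :+ con (+ 54) :* (t :* Z :* Z :* ZP.cube Z) :+ con (+ 27) :*
          (ZP.cube Z :* ZP.cube Z)
        :+ X :* X :* X :* X :* Y :+ con (+ 9) :* (X :* X :* Y :* Y) :+ con (+ 27) :* ZP.cube Y)) ≡.refl t Z Y

  -- Here the coefficients 9 and 18 of t⁸Z meet; nothing else of order below 27 involves Z.
  product-mod-27 : ∀ t Z A B → (cube t + + 9 * (t * t * Z) + + 27 * A) *
      (cube t * cube t + + 18 * (cube t * t * t * Z) + + 27 * B) ≡
    cube (cube t) + + 27 * (cube t * cube t * t * t * Z + + 6 * (cube t * cube t * t * Z * Z) + A *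
        (cube t * cube t + + 18 * (cube t * t * t * Z) + + 27 * B) + B * (cube t + + 9 * (t * t * Z)))
  product-mod-27 = solve 4 (λ t Z A B → (ZP.cube t :+ con (+ 9) :* (t :* t :* Z) :+ con (+ 27) :* A) :*
      (ZP.cube t :* ZP.cube t :+ con (+ 18) :* (ZP.cube t :* t :* t :* Z) :+ con (+ 27) :* B) :=
    ZP.cube (ZP.cube t) :+ con (+ 27) :* (ZP.cube t :* ZP.cube t :* t :* t :* Z :+ con (+ 6) :*
        (ZP.cube t :* ZP.cube t :* t :* Z :* Z) :+ A :* (ZP.cube t :* ZP.cube t :+ con (+ 18) :*
        (ZP.cube t :* t :* t :* Z) :+ con (+ 27) :* B) :+ B :* (ZP.cube t :+ con (+ 9) :* (t :* t :* Z)))) ≡.refl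

  -- Residues modulo 3 and the two cases for s

  -- The third class is represented by -1, which every odd power preserves, so that it can be
  -- treated like the class of 1.
  data Mod3 (a : ℤ) : Set where
    0-mod : ∀ k → a ≡ + 3 * k → Mod3 a
    1-mod : ∀ k → a ≡ + 1 + + 3 * k → Mod3 a
    2-mod : ∀ k → a ≡ - + 1 + + 3 * k → Mod3 a

  mod3 : ∀ a → Mod3 a
  mod3 a with a %ℕ 3 | n%ℕd<d a 3 | a /ℕ 3 | a≡a%ℕn+[a/ℕn]*n a 3
  ... | 0 | _ | k | eq = 0-mod k (≡.trans eq (≡.trans (ℤₚ.+-identityˡ (k * + 3)) (ℤₚ.*-comm k (+ 3))))
  ... | 1 | _ | k | eq = 1-mod k (≡.trans eq (≡.cong (λ x → + 1 + x) (ℤₚ.*-comm k (+ 3))))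
  ... | 2 | _ | k | eq = 2-mod (+ 1 + k) (≡.trans eq (lemma k))
    where
    lemma : ∀ k → + 2 + k * + 3 ≡ - + 1 + + 3 * (+ 1 + k)
    lemma = solve-∀
  ... | suc (suc (suc _)) | s≤s (s≤s (s≤s ())) | _ | _

  3∤1 : ¬ (+ 3 Signed.∣ + 1)
  3∤1 = from-no (+ 3 Signed.∣? + 1)

  not-1-mod-3 : ∀ {x} q → x ≡ + 1 + + 3 * q → ¬ (+ 3 Signed.∣ x)
  not-1-mod-3 q x≡ (divides r x≡′) = 3∤1 (divides (r - q)
      (≡.trans (add q) (≡.trans (≡.cong (λ x → x - + 3 * q) (≡.trans (≡.sym x≡) x≡′)) (factor r q))))
    where
    add : ∀ q → + 1 ≡ + 1 + + 3 * q - + 3 * q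
    add = solve-∀
    factor : ∀ r q → r * + 3 - + 3 * q ≡ (r - q) * + 3
    factor = solve-∀

  not-2-mod-3 : ∀ {x} q → x ≡ - + 1 + + 3 * q → ¬ (+ 3 Signed.∣ x)
  not-2-mod-3 q x≡ (divides r x≡′) = 3∤1 (divides (q - r)
      (≡.trans (add q) (≡.trans (≡.cong (λ x → + 3 * q - x) (≡.trans (≡.sym x≡) x≡′)) (factor r q))))
    where
    add : ∀ q → + 1 ≡ + 3 * q - (- + 1 + + 3 * q)
    add = solve-∀
    factor : ∀ r q → + 3 * q - r * + 3 ≡ (q - r) * + 3
    factor = solve-∀

  -- The shape of a group determinant: s is the augmentation, s² - 3w, …, s² - 3z are the norms of the
  -- four conjugate pairs of nontrivial characters, and X² + 9Y is the norm of the determinant of ρ.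
  shape : (s w x y z X Y : ℤ) → ℤ
  shape s w x y z X Y = s * ((s * s - + 3 * w) * ((s * s - + 3 * x) * ((s * s - + 3 * y) * (s * s - + 3 * z))))
    * ((X * X + + 9 * Y) * ((X * X + + 9 * Y) * (X * X + + 9 * Y)))

  module Congruences {s w x y z X E K F} (sum≡ : w + x + y + z ≡ + 3 * E) (pairs≡ : σ₂ w x y z ≡ s * K + + 3 * F)
           (X≡ : X ≡ cube s + + 3 * (K - s * E)) (Y : ℤ) where

    shape-mod-27 : ∃ λ q → shape s w x y z X Y ≡ cube (cube (cube s)) + + 27 * q
    shape-mod-27 = let (A , linear≡) = linear-part ; (B , norm≡) = norm-part in
      _ , ≡.trans (≡.cong₂ _*_ linear≡ norm≡) (product-mod-27 (cube s) (K - s * E) A B)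
      where
      linear-part : ∃ λ A → s * ((s * s - + 3 * w) * ((s * s - + 3 * x) * ((s * s - + 3 * y) * (s * s - + 3 * z)))) ≡
                       cube (cube s) + + 9 * (cube s * cube s * (K - s * E)) + + 27 * A
      linear-part = let (A , eq) = e₂-product s w x y z in _ , ≡.trans eq (≡.trans
        (≡.cong₂ (λ p q → cube (cube s) - + 3 * (s * cube s * cube s * p) + + 9 * (s * s * cube s * q) + + 27 *
            A) sum≡ pairs≡)
        (substitute-symmetric s E K F A))
      norm-part : ∃ λ B → (X * X + + 9 * Y) * ((X * X + + 9 * Y) * (X * X + + 9 * Y)) ≡
                     cube (cube s) * cube (cube s) + + 18 * (cube (cube s) * cube s * cube s * (K - s * E)) + + 27 * B
      norm-part = ≡.subst (λ X → ∃ λ B → (X * X + + 9 * Y) * ((X * X + + 9 * Y) * (X * X + + 9 * Y)) ≡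
                     cube (cube s) * cube (cube s) + + 18 * (cube (cube s) * cube s * cube s * (K - s * E)) + +
                         27 * B)
               (≡.sym X≡) (nrm-cube (cube s) (K - s * E) Y)

  9*3 : ∀ x q → x + + 9 * (+ 3 * q) ≡ x + + 27 * q
  9*3 = solve-∀

  cube-1-mod-9 : ∀ k → ∃ λ m → cube (+ 1 + + 3 * k) ≡ + 1 + + 9 * m
  cube-1-mod-9 k = k + + 3 * (k * k) + + 3 * cube k , solve 1 (λ k → ZP.cube (con (+ 1) :+ con (+ 3) :* k) :=
    con (+ 1) :+ con (+ 9) :* (k :+ con (+ 3) :* (k :* k) :+ con (+ 3) :* ZP.cube k)) ≡.refl k

  -- The multiple of 27 is written as 9 times 3q so that the lemma applies to its own output, as the
  -- third cubing requires.
  cube-1-mod-27 : ∀ m → ∃ λ q → cube (+ 1 + + 9 * m) ≡ + 1 + + 9 * (+ 3 * q)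
  cube-1-mod-27 m = m + + 9 * (m * m) + + 27 * cube m , solve 1 (λ m → ZP.cube (con (+ 1) :+ con (+ 9) :* m) :=
    con (+ 1) :+ con (+ 9) :* (con (+ 3) :* (m :+ con (+ 9) :* (m :* m) :+ con (+ 27) :* ZP.cube m))) ≡.refl m

  27th-power-1-mod : ∀ {s} k → s ≡ + 1 + + 3 * k → ∃ λ q → cube (cube (cube s)) ≡ + 1 + + 27 * q
  27th-power-1-mod k s≡ =
    let (m , p) = cube-1-mod-9 k ; (l , p′) = cube-1-mod-27 m ; (q , p″) = cube-1-mod-27 (+ 3 * l) in
    q , ≡.trans (≡.cong (λ s → cube (cube (cube s))) s≡) (≡.trans (≡.cong (λ s → cube (cube s)) p)
      (≡.trans (≡.cong cube p′) (≡.trans p″ (9*3 (+ 1) q))))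

  cube-2-mod-9 : ∀ k → ∃ λ m → cube (- + 1 + + 3 * k) ≡ - + 1 + + 9 * m
  cube-2-mod-9 k = k - + 3 * (k * k) + + 3 * cube k , solve 1 (λ k → ZP.cube (con (- + 1) :+ con (+ 3) :* k) :=
    con (- + 1) :+ con (+ 9) :* (k :- con (+ 3) :* (k :* k) :+ con (+ 3) :* ZP.cube k)) ≡.refl k

  cube-2-mod-27 : ∀ m → ∃ λ q → cube (- + 1 + + 9 * m) ≡ - + 1 + + 9 * (+ 3 * q)
  cube-2-mod-27 m = m - + 9 * (m * m) + + 27 * cube m , solve 1 (λ m → ZP.cube (con (- + 1) :+ con (+ 9) :* m) :=
    con (- + 1) :+ con (+ 9) :* (con (+ 3) :* (m :- con (+ 9) :* (m :* m) :+ con (+ 27) :* ZP.cube m))) ≡.refl m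

  27th-power-2-mod : ∀ {s} k → s ≡ - + 1 + + 3 * k → ∃ λ q → cube (cube (cube s)) ≡ - + 1 + + 27 * q
  27th-power-2-mod k s≡ =
    let (m , p) = cube-2-mod-9 k ; (l , p′) = cube-2-mod-27 m ; (q , p″) = cube-2-mod-27 (+ 3 * l) in
    q , ≡.trans (≡.cong (λ s → cube (cube (cube s))) s≡) (≡.trans (≡.cong (λ s → cube (cube s)) p)
      (≡.trans (≡.cong cube p′) (≡.trans p″ (9*3 (- + 1) q))))

  square-mod-3 : ∀ a → (∃ λ k → a ≡ + 3 * k) ⊎ (∃ λ k → a * a ≡ + 1 + + 3 * k)
  square-mod-3 a with mod3 a
  ... | 0-mod k eq = inj₁ (k , eq)
  ... | 1-mod k eq = inj₂ (+ 2 * k + + 3 * (k * k) , ≡.trans (≡.cong₂ _*_ eq eq) (lemma k))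
    where
    lemma : ∀ k → (+ 1 + + 3 * k) * (+ 1 + + 3 * k) ≡ + 1 + + 3 * (+ 2 * k + + 3 * (k * k))
    lemma = solve-∀
  ... | 2-mod k eq = inj₂ (- (+ 2 * k) + + 3 * (k * k) , ≡.trans (≡.cong₂ _*_ eq eq) (lemma k))
    where
    lemma : ∀ k → (- + 1 + + 3 * k) * (- + 1 + + 3 * k) ≡ + 1 + + 3 * (- (+ 2 * k) + + 3 * (k * k))
    lemma = solve-∀

  -- If none of w, x, y, z were divisible by 3, the sum of their squares would be 1 modulo 3.
  3∣product : ∀ w x y z {q} → w * w + x * x + y * y + z * z ≡ + 3 * q → ∃ λ r → w * (x * (y * z)) ≡ + 3 * r
  3∣product w x y z eq with square-mod-3 w | square-mod-3 x | square-mod-3 y | square-mod-3 z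
  ... | inj₁ (k , p) | _ | _ | _ = k * (x * (y * z)) , ≡.trans (≡.cong (λ w → w * (x * (y * z))) p) (lemma k x y z)
    where
    lemma : ∀ k x y z → + 3 * k * (x * (y * z)) ≡ + 3 * (k * (x * (y * z)))
    lemma = solve-∀
  ... | inj₂ _ | inj₁ (k , p) | _ | _ = w * (k * (y * z)) , ≡.trans (≡.cong (λ x → w * (x * (y * z))) p)
      (lemma w k y z)
    where
    lemma : ∀ w k y z → w * (+ 3 * k * (y * z)) ≡ + 3 * (w * (k * (y * z)))
    lemma = solve-∀
  ... | inj₂ _ | inj₂ _ | inj₁ (k , p) | _ = w * (x * (k * z)) , ≡.trans (≡.cong (λ y → w * (x * (y * z))) p)
      (lemma w x k z)
    where
    lemma : ∀ w x k z → w * (x * (+ 3 * k * z)) ≡ + 3 * (w * (x * (k * z)))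
    lemma = solve-∀
  ... | inj₂ _ | inj₂ _ | inj₂ _ | inj₁ (k , p) = w * (x * (y * k)) , ≡.trans
      (≡.cong (λ z → w * (x * (y * z))) p) (lemma w x y k)
    where
    lemma : ∀ w x y k → w * (x * (y * (+ 3 * k))) ≡ + 3 * (w * (x * (y * k)))
    lemma = solve-∀
  3∣product w x y z {q} eq | inj₂ (a , p) | inj₂ (b , p′) | inj₂ (c , p″) | inj₂ (d , p‴) =
    ⊥-elim (not-1-mod-3 (+ 1 + a + b + c + d) (≡.trans (≡.cong₂ _+_ (≡.cong₂ _+_ (≡.cong₂ _+_ p p′) p″) p‴)
        (lemma a b c d))
      (divides q (≡.trans eq (ℤₚ.*-comm (+ 3) q))))
    where
    lemma : ∀ a b c d → + 1 + + 3 * a + (+ 1 + + 3 * b) + (+ 1 + + 3 * c) + (+ 1 + + 3 * d) ≡ + 1 + + 3 *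
        (+ 1 + a + b + c + d)
    lemma = solve-∀

  -- Multiplies a congruence modulo 3 by one more factor `3 v - w`, which is `- w`; iterating it
  -- reduces the product of four such factors.
  product-mod-3 : ∀ v w {P Q C} → P ≡ Q + + 3 * C → ∃ λ D → (+ 3 * v - w) * P ≡ - (w * Q) + + 3 * D
  product-mod-3 v w {P} {Q} {C} P≡ = v * Q + + 3 * (v * C) - w * C , ≡.trans (≡.cong ((+ 3 * v - w) *_) P≡)
      (expand v w Q C)
    where
    expand : ∀ v w Q C → (+ 3 * v - w) * (Q + + 3 * C) ≡ - (w * Q) + + 3 * (v * Q + + 3 * (v * C) - w * C)
    expand = solve-∀

  linear-divisible : ∀ k {w x y z r} → w * (x * (y * z)) ≡ + 3 * r → ∃ λ q →
    + 3 * k * ((+ 3 * k * (+ 3 * k) - + 3 * w) * ((+ 3 * k * (+ 3 * k) - + 3 * x) *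
      ((+ 3 * k * (+ 3 * k) - + 3 * y) * (+ 3 * k * (+ 3 * k) - + 3 * z)))) ≡ + 729 * q
  linear-divisible k {w} {x} {y} {z} {r} wxyz≡ =
    -- Each norm is 3(3k² - w). Together with s = 3k this gives 3⁵ = 243, and the four brackets
    -- multiply to `w x y z` modulo 3, the source of the sixth factor 3. The iteration starts from
    -- the innermost bracket.
    let v = k * k
        (B₁ , B₁≡) = product-mod-3 v y {P = + 3 * v - z} {Q = - z} {C = v} (ℤₚ.+-comm (+ 3 * v) (- z))
        (B₂ , B₂≡) = product-mod-3 v x B₁≡
        (B₃ , B₃≡) = product-mod-3 v w B₂≡
    in k * (r + B₃) ,
      ≡.trans (≡.cong₂ (λ a b → + 3 * k * (a * b)) (factor k w)
          (≡.cong₂ _*_ (factor k x) (≡.cong₂ _*_ (factor k y) (factor k z))))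
      (≡.trans (pull k (+ 3 * v - w) (+ 3 * v - x) (+ 3 * v - y) (+ 3 * v - z))
      (≡.trans (≡.cong (λ p → + 243 * (k * p)) (≡.trans B₃≡
          (≡.cong (λ p → p + + 3 * B₃) (≡.trans (signs w x y z) wxyz≡))))
        (collect k r B₃)))
    where
    factor : ∀ k w → + 3 * k * (+ 3 * k) - + 3 * w ≡ + 3 * (+ 3 * (k * k) - w)
    factor = solve-∀
    pull : ∀ k a b c d → + 3 * k * (+ 3 * a * (+ 3 * b * (+ 3 * c * (+ 3 * d)))) ≡ + 243 * (k * (a * (b * (c * d))))
    pull = solve-∀
    signs : ∀ w x y z → - (w * - (x * - (y * - z))) ≡ w * (x * (y * z))
    signs = solve-∀
    collect : ∀ k r B → + 243 * (k * (+ 3 * r + + 3 * B)) ≡ + 729 * (k * (r + B))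
    collect = solve-∀

  -- Newton's identity for the second power sum turns the two symmetric relations into the
  -- hypothesis of `3∣product`.
  sum-of-squares : ∀ w x y z {k E K F} → w + x + y + z ≡ + 3 * E → σ₂ w x y z ≡ + 3 * k * K + + 3 * F →
                   w * w + x * x + y * y + z * z ≡ + 3 * (+ 3 * (E * E) - + 2 * (k * K + F))
  sum-of-squares w x y z {k} {E} {K} {F} sum≡ pairs≡ = ≡.trans (newton w x y z)
    (≡.trans (≡.cong₂ (λ p q → p * p - + 2 * q) sum≡ pairs≡) (collect k E K F))
    where
    newton : ∀ w x y z → w * w + x * x + y * y + z * z ≡ (w + x + y + z) * (w + x + y + z) - + 2 * σ₂ w x y z
    newton = solve 4 (λ w x y z → w :* w :+ x :* x :+ y :* y :+ z :* z :=
      (w :+ x :+ y :+ z) :* (w :+ x :+ y :+ z) :- con (+ 2) :* ZP.σ₂ w x y z) ≡.refl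
    collect : ∀ k E K F → + 3 * E * (+ 3 * E) - + 2 * (+ 3 * k * K + + 3 * F) ≡ + 3 *
        (+ 3 * (E * E) - + 2 * (k * K + F))
    collect = solve-∀

  norm-divisible : ∀ k Z Y {X} → X ≡ cube (+ 3 * k) + + 3 * Z → ∃ λ q → X * X + + 9 * Y ≡ + 9 * q
  norm-divisible k Z Y X≡ = (+ 9 * cube k + Z) * (+ 9 * cube k + Z) + Y , ≡.trans
      (≡.cong (λ X → X * X + + 9 * Y) X≡) (collect k Z Y)
    where
    collect : ∀ k Z Y → (cube (+ 3 * k) + + 3 * Z) * (cube (+ 3 * k) + + 3 * Z) + + 9 * Y ≡ + 9 *
        ((+ 9 * cube k + Z) * (+ 9 * cube k + Z) + Y)
    collect = solve 3 (λ k Z Y → (ZP.cube (con (+ 3) :* k) :+ con (+ 3) :* Z) :*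
        (ZP.cube (con (+ 3) :* k) :+ con (+ 3) :* Z) :+ con (+ 9) :* Y :=
      con (+ 9) :* ((con (+ 9) :* ZP.cube k :+ Z) :* (con (+ 9) :* ZP.cube k :+ Z) :+ Y)) ≡.refl

  shape-divisible : ∀ {s w x y z X E K F} → w + x + y + z ≡ + 3 * E → σ₂ w x y z ≡ s * K + + 3 * F →
                    X ≡ cube s + + 3 * (K - s * E) → ∀ Y k → s ≡ + 3 * k → ∃ λ q → shape s w x y z X Y ≡ +
                        (3 ^ 12) * q
  shape-divisible {w = w} {x} {y} {z} {X} {E} {K} {F} sum≡ pairs≡ X≡ Y k ≡.refl =
    let (r , wxyz≡) = 3∣product w x y z (sum-of-squares w x y z {k} {E} {K} {F} sum≡ pairs≡)
        (a , linear≡) = linear-divisible k {w} {x} {y} {z} {r} wxyz≡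
        (n , norm≡) = norm-divisible k (K - + 3 * k * E) Y X≡
    in a * (n * n * n) , ≡.trans (≡.cong₂ (λ l n → l * (n * (n * n))) linear≡ norm≡)
        (≡.trans (collect (+ 729) (+ 9) a n) (≡.cong (_* (a * (n * n * n))) constant))
    where
    collect : ∀ c d a n → c * a * (d * n * (d * n * (d * n))) ≡ c * (d * (d * d)) * (a * (n * n * n))
    collect = solve-∀
    constant : + 729 * (+ 9 * (+ 9 * + 9)) ≡ + (3 ^ 12)
    constant = ≡.refl

  -- The relations satisfied by a group determinant

  at : (ℤ → ℤ → ℤ → ℤ → ℤ → ℤ → ℤ → ℤ → ℤ → ℤ) → (H₃ → ℤ) → ℤ
  at F f = F (β f 0F) (β f 1F) (β f 2F) (β f 3F) (β f 4F) (β f 5F) (β f 6F) (β f 7F) (β f 8F)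

  -- Traces of multiples of ω - 1 are divisible by 3, so the cross term is divisible by 9; the norm
  -- of 3(ω - 1) is 27.
  norm-residue : ∀ X q {Δ} → Δ ≡ ι X ⊹ ι (+ 3) ⋆ ω-1 ⋆ q → ∃ λ Y → nrm Δ ≡ X * X + + 9 * Y
  norm-residue X (c + d ω) ≡.refl = (c + d) * (c + d) + (c + d) * (c - + 2 * d) + (c - + 2 * d) * (c - + 2 * d)
      - c * X , expand X c d
    where
    expand : ∀ X c d → (X + (- + 3 * c - + 3 * d)) * (X + (- + 3 * c - + 3 * d)) - (X + (- + 3 * c - + 3 * d)) *
        (+ 0 + (- + 3 * d + + 3 * c - + 3 * d))
      + (+ 0 + (- + 3 * d + + 3 * c - + 3 * d)) * (+ 0 + (- + 3 * d + + 3 * c - + 3 * d)) ≡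
      X * X + + 9 * ((c + d) * (c + d) + (c + d) * (c - + 2 * d) + (c - + 2 * d) * (c - + 2 * d) - c * X)
    expand = solve-∀

  -- Everything the congruences use about `f`, stated for free integers, so that they are proved
  -- without the large polynomials in the nine fibre sums.
  record Shape (D : ℤ) : Set where
    field
      s w x y z X E K F Y : ℤ
      sum≡   : w + x + y + z ≡ + 3 * E
      pairs≡ : σ₂ w x y z ≡ s * K + + 3 * F
      X≡     : X ≡ cube s + + 3 * (K - s * E)
      D≡     : D ≡ shape s w x y z X Y

  mkShape : ∀ a b c d e f g h i {D} Y → D ≡ shape (total a b c d e f g h i) (e₂₁ a b c d e f g h i)
      (e₂₂ a b c d e f g h i) (e₂₃ a b c d e f g h i) (e₂₄ a b c d e f g h i) (cubic a b c d e f g h i) Y → Shape D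
  mkShape a b c d e f g h i Y D≡ = record
    { s = total a b c d e f g h i ; w = e₂₁ a b c d e f g h i ; x = e₂₂ a b c d e f g h i ; y = e₂₃ a b c d e f
        g h i ; z = e₂₄ a b c d e f g h i ; X = cubic a b c d e f g h i
    ; E = E₂ a b c d e f g h i ; K = E₃ a b c d e f g h i - lines (+ 1) (+ 1) a b c d e f g h i ; F = E₂ a b c d
        e f g h i * E₂ a b c d e f g h i - arcs a b c d e f g h i ; Y = Y
    ; sum≡ = e₂-sum a b c d e f g h i ; pairs≡ = e₂-pairs a b c d e f g h i ; X≡ = cubic-value a b c d e f g h i
        ; D≡ = D≡ }

  groupDet-shape : ∀ f → Shape (groupDet f)
  groupDet-shape f =
    let (q , Δ≡) = Δ-residue f
        (Y , norm≡) = norm-residue (cubic (β f 0F) (β f 1F) (β f 2F) (β f 3F) (β f 4F) (β f 5F) (β f 6F)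
            (β f 7F) (β f 8F)) q Δ≡
    in mkShape (β f 0F) (β f 1F) (β f 2F) (β f 3F) (β f 4F) (β f 5F) (β f 6F) (β f 7F) (β f 8F) Y
        (≡.trans (groupDet-value f) (≡.cong₂ (λ l n → l * (n * (n * n)))
      (≡.cong (total (β f 0F) (β f 1F) (β f 2F) (β f 3F) (β f 4F) (β f 5F) (β f 6F) (β f 7F) (β f 8F) *_)
        (≡.cong₂ _*_ (norm₁-value (β f 0F) (β f 1F) (β f 2F) (β f 3F) (β f 4F) (β f 5F) (β f 6F) (β f 7F) (β f 8F))
        (≡.cong₂ _*_ (norm₂-value (β f 0F) (β f 1F) (β f 2F) (β f 3F) (β f 4F) (β f 5F) (β f 6F) (β f 7F) (β f 8F))
        (≡.cong₂ _*_ (norm₃-value (β f 0F) (β f 1F) (β f 2F) (β f 3F) (β f 4F) (β f 5F) (β f 6F) (β f 7F) (β f 8F))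
                     (norm₄-value (β f 0F) (β f 1F) (β f 2F) (β f 3F) (β f 4F) (β f 5F) (β f 6F) (β f 7F)
                         (β f 8F))))))
      norm≡))

open Residues

-- Realising values by adding constants

module Values where

  open Data.Integer.Solver.+-*-Solver using (solve; con; _:+_; _:*_; _:=_)
  open Determinant 𝔼-ring
  open ℤP
  open ≡.≡-Reasoning
  open import Data.Vec using (Vec; []; _∷_; lookup; replicate)

  cofactor : (H₃ → ℤ) → ℤ
  cofactor f = at norm₁ f * (at norm₂ f * (at norm₃ f * at norm₄ f)) * (nrm (Δ f) * (nrm (Δ f) * nrm (Δ f)))

  groupDet-cofactor : ∀ f → groupDet f ≡ at total f * cofactor f
  groupDet-cofactor f = ≡.trans (groupDet-value f)
    (ℤₚ.*-assoc (at total f) (at norm₁ f * (at norm₂ f * (at norm₃ f * at norm₄ f)))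
        (nrm (Δ f) * (nrm (Δ f) * nrm (Δ f))))

  shift : ℤ → (H₃ → ℤ) → H₃ → ℤ
  shift c f g = c + f g

  δ-sum : ∀ t → ℤ-Det.sum (δ t) ≡ + 3
  δ-sum = from-yes (all? λ t → ℤ-Det.sum (δ t) Int.≟ + 3)

  -- Summing a nontrivial irreducible representation over the group gives 0, here already because
  -- `z` is a scalar different from 1. Hence constants do not affect ρ(f).
  ρ-sum : ∀ l j → sum (λ k → ρ (enum k) l j) ≡ ι (+ 0)
  ρ-sum = from-yes (all? λ l → all? λ j → sum (λ k → ρ (enum k) l j) ≟ᴱ ι (+ 0))

  opaque
    unfolding form β

    β-shift : ∀ c f t → β (shift c f) t ≡ c * + 3 + β f t
    β-shift c f t = begin
      ℤ-Det.sum (λ k → (c + f (enum k)) * δ t k)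
        ≡⟨ ℤ-Det.sum-cong (λ k → (c + f (enum k)) * δ t k) (λ k → c * δ t k + f (enum k) * δ t k)
            (λ k → ℤₚ.*-distribʳ-+ (δ t k) c (f (enum k))) ⟩
      ℤ-Det.sum (λ k → c * δ t k + f (enum k) * δ t k)
        ≡⟨ ℤ-Det.sum-linear c (δ t) (λ k → f (enum k) * δ t k) ⟩
      c * ℤ-Det.sum (δ t) + ℤ-Det.sum (λ k → f (enum k) * δ t k)
        ≡⟨ ≡.cong (λ x → c * x + ℤ-Det.sum (λ k → f (enum k) * δ t k)) (δ-sum t) ⟩
      c * + 3 + ℤ-Det.sum (λ k → f (enum k) * δ t k) ∎

    ρ̂-shift : ∀ c f l j → hat ρ (shift c f) l j ≡ hat ρ f l j
    ρ̂-shift c f l j = begin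
      sum (λ k → ι (c + f (enum k)) ⋆ ρ (enum k) l j)
        ≡⟨ sum-cong (λ k → ι (c + f (enum k)) ⋆ ρ (enum k) l j)
            (λ k → ι c ⋆ ρ (enum k) l j ⊹ ι (f (enum k)) ⋆ ρ (enum k) l j)
             (λ k → R.distribʳ (ρ (enum k) l j) (ι c) (ι (f (enum k)))) ⟩
      sum (λ k → ι c ⋆ ρ (enum k) l j ⊹ ι (f (enum k)) ⋆ ρ (enum k) l j)
        ≡⟨ sum-linear (ι c) (λ k → ρ (enum k) l j) (λ k → ι (f (enum k)) ⋆ ρ (enum k) l j) ⟩
      ι c ⋆ sum (λ k → ρ (enum k) l j) ⊹ hat ρ f l j
        ≡⟨ ≡.cong (λ x → ι c ⋆ x ⊹ hat ρ f l j) (ρ-sum l j) ⟩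
      ι c ⋆ ι (+ 0) ⊹ hat ρ f l j
        ≡⟨ ≡.cong (_⊹ hat ρ f l j) (R.zeroʳ (ι c)) ⟩
      ι (+ 0) ⊹ hat ρ f l j
        ≡⟨ R.+-identityˡ (hat ρ f l j) ⟩
      hat ρ f l j ∎

  Δ-shift : ∀ c f → Δ (shift c f) ≡ Δ f
  Δ-shift c f = Det-cong 3 (hat ρ (shift c f)) (hat ρ f) (ρ̂-shift c f)

  at-shift : ∀ F c f → at F (shift c f) ≡ F (c * + 3 + β f 0F) (c * + 3 + β f 1F) (c * + 3 + β f 2F)
      (c * + 3 + β f 3F)
    (c * + 3 + β f 4F) (c * + 3 + β f 5F) (c * + 3 + β f 6F) (c * + 3 + β f 7F) (c * + 3 + β f 8F)
  at-shift F c f rewrite β-shift c f 0F | β-shift c f 1F | β-shift c f 2F | β-shift c f 3F | β-shift c f 4F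
    | β-shift c f 5F | β-shift c f 6F | β-shift c f 7F | β-shift c f 8F = ≡.refl

  total-shift : ∀ c f → at total (shift c f) ≡ c * + 27 + at total f
  total-shift c f = ≡.trans (at-shift total c f) (lemma c (β f 0F) (β f 1F) (β f 2F) (β f 3F) (β f 4F) (β f 5F)
      (β f 6F) (β f 7F) (β f 8F))
    where
    lemma : ∀ t a b c d e f g h i → total (t * + 3 + a) (t * + 3 + b) (t * + 3 + c) (t * + 3 + d) (t * + 3 + e)
        (t * + 3 + f) (t * + 3 + g) (t * + 3 + h) (t * + 3 + i) ≡
      t * + 27 + total a b c d e f g h i
    lemma = solve 10 (λ t a b c d e f g h i → let t₃ = t :* con (+ 3) in ZP.total (t₃ :+ a) (t₃ :+ b) (t₃ :+ c) (t₃ :+ d) (t₃ :+ e) (t₃ :+ f) (t₃ :+ g) (t₃ :+ h) (t₃ :+ i) :=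
      t :* con (+ 27) :+ ZP.total a b c d e f g h i) ≡.refl

  -- The norm form depends only on differences of its arguments, and all three line sums rise by the
  -- same 9t.
  norm-shift : ∀ t p q r p′ q′ r′ p″ q″ r″ → norm (t * + 3 + p + (t * + 3 + q) + (t * + 3 + r))
      (t * + 3 + p′ + (t * + 3 + q′) + (t * + 3 + r′)) (t * + 3 + p″ + (t * + 3 + q″) + (t * + 3 + r″)) ≡
    norm (p + q + r) (p′ + q′ + r′) (p″ + q″ + r″)
  norm-shift = solve 10 (λ t p q r p′ q′ r′ p″ q″ r″ → let t₃ = t :* con (+ 3) in
    ZP.norm (t₃ :+ p :+ (t₃ :+ q) :+ (t₃ :+ r)) (t₃ :+ p′ :+ (t₃ :+ q′) :+ (t₃ :+ r′))
        (t₃ :+ p″ :+ (t₃ :+ q″) :+ (t₃ :+ r″)) :=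
    ZP.norm (p :+ q :+ r) (p′ :+ q′ :+ r′) (p″ :+ q″ :+ r″)) ≡.refl

  cofactor-shift : ∀ c f → cofactor (shift c f) ≡ cofactor f
  cofactor-shift c f = ≡.cong₂ _*_
    -- For each parallel class the fibre sums are listed line by line.
    (≡.cong₂ _*_ (≡.trans (at-shift norm₁ c f) (norm-shift c (β f 0F) (β f 1F) (β f 2F) (β f 3F) (β f 4F)
        (β f 5F) (β f 6F) (β f 7F) (β f 8F)))
    (≡.cong₂ _*_ (≡.trans (at-shift norm₂ c f) (norm-shift c (β f 0F) (β f 3F) (β f 6F) (β f 1F) (β f 4F)
        (β f 7F) (β f 2F) (β f 5F) (β f 8F)))
    (≡.cong₂ _*_ (≡.trans (at-shift norm₃ c f) (norm-shift c (β f 0F) (β f 4F) (β f 8F) (β f 1F) (β f 5F)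
        (β f 6F) (β f 2F) (β f 3F) (β f 7F)))
                 (≡.trans (at-shift norm₄ c f) (norm-shift c (β f 0F) (β f 5F) (β f 7F) (β f 1F) (β f 3F)
                     (β f 8F) (β f 2F) (β f 4F) (β f 6F))))))
    (≡.cong (λ z → nrm z * (nrm z * nrm z)) (Δ-shift c f))

  -- The digit 2 stands for the value -1.
  digits : Vec ℕ 27 → H₃ → ℤ
  digits v g with lookup v (index g)
  ... | 0 = + 0
  ... | 1 = + 1
  ... | _ = - + 1

  -- Found by computer search.
  generator : Fin 9 → H₃ → ℤ
  generator 0F = digits (0 ∷ 0 ∷ 0 ∷ 0 ∷ 0 ∷ 1 ∷ 0 ∷ 2 ∷ 0 ∷ 0 ∷ 0 ∷ 0 ∷ 0 ∷ 1 ∷ 0 ∷ 0 ∷ 0 ∷ 0 ∷ 2 ∷ 0 ∷ 0 ∷ 0 ∷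
      0 ∷ 0 ∷ 0 ∷ 0 ∷ 0 ∷ [])
  generator 1F = digits (0 ∷ 0 ∷ 0 ∷ 2 ∷ 0 ∷ 0 ∷ 1 ∷ 0 ∷ 0 ∷ 0 ∷ 0 ∷ 0 ∷ 0 ∷ 1 ∷ 0 ∷ 0 ∷ 0 ∷ 0 ∷ 0 ∷ 0 ∷ 0 ∷ 0 ∷
      1 ∷ 0 ∷ 0 ∷ 0 ∷ 1 ∷ [])
  generator 2F = digits (1 ∷ 0 ∷ 0 ∷ 1 ∷ 0 ∷ 0 ∷ 0 ∷ 0 ∷ 0 ∷ 1 ∷ 0 ∷ 1 ∷ 0 ∷ 0 ∷ 0 ∷ 0 ∷ 0 ∷ 1 ∷ 0 ∷ 1 ∷ 0 ∷ 0 ∷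
      0 ∷ 0 ∷ 0 ∷ 0 ∷ 0 ∷ [])
  generator 3F = digits (0 ∷ 0 ∷ 0 ∷ 0 ∷ 1 ∷ 0 ∷ 1 ∷ 0 ∷ 0 ∷ 0 ∷ 0 ∷ 0 ∷ 0 ∷ 0 ∷ 1 ∷ 1 ∷ 1 ∷ 0 ∷ 1 ∷ 0 ∷ 0 ∷ 0 ∷
      1 ∷ 1 ∷ 0 ∷ 0 ∷ 1 ∷ [])
  generator 4F = digits (1 ∷ 0 ∷ 1 ∷ 0 ∷ 1 ∷ 0 ∷ 1 ∷ 0 ∷ 0 ∷ 1 ∷ 0 ∷ 1 ∷ 0 ∷ 0 ∷ 1 ∷ 0 ∷ 0 ∷ 0 ∷ 0 ∷ 0 ∷ 1 ∷ 1 ∷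
      1 ∷ 0 ∷ 1 ∷ 1 ∷ 0 ∷ [])
  generator 5F = digits (1 ∷ 0 ∷ 1 ∷ 0 ∷ 1 ∷ 0 ∷ 1 ∷ 1 ∷ 1 ∷ 1 ∷ 0 ∷ 1 ∷ 0 ∷ 1 ∷ 0 ∷ 1 ∷ 1 ∷ 0 ∷ 1 ∷ 0 ∷ 0 ∷ 1 ∷
      1 ∷ 0 ∷ 0 ∷ 0 ∷ 1 ∷ [])
  generator 6F = digits (0 ∷ 0 ∷ 0 ∷ 0 ∷ 2 ∷ 0 ∷ 2 ∷ 0 ∷ 0 ∷ 0 ∷ 0 ∷ 0 ∷ 0 ∷ 0 ∷ 2 ∷ 2 ∷ 2 ∷ 0 ∷ 2 ∷ 0 ∷ 0 ∷ 0 ∷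
      2 ∷ 2 ∷ 0 ∷ 0 ∷ 2 ∷ [])
  generator 7F = digits (2 ∷ 0 ∷ 2 ∷ 0 ∷ 2 ∷ 0 ∷ 0 ∷ 0 ∷ 0 ∷ 0 ∷ 0 ∷ 0 ∷ 0 ∷ 2 ∷ 0 ∷ 0 ∷ 0 ∷ 0 ∷ 0 ∷ 0 ∷ 0 ∷ 0 ∷
      2 ∷ 0 ∷ 0 ∷ 0 ∷ 2 ∷ [])
  generator 8F = digits (2 ∷ 0 ∷ 0 ∷ 0 ∷ 0 ∷ 0 ∷ 0 ∷ 0 ∷ 2 ∷ 2 ∷ 0 ∷ 0 ∷ 0 ∷ 0 ∷ 1 ∷ 2 ∷ 0 ∷ 0 ∷ 0 ∷ 0 ∷ 0 ∷ 0 ∷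
      0 ∷ 0 ∷ 0 ∷ 0 ∷ 0 ∷ [])

  -- A third of the sum of the values of `generator r`. The representatives run from -3 to 5, and
  -- together they cover every class modulo 9.
  offset : Fin 9 → ℤ
  offset r = lookup (+ 0 ∷ + 1 ∷ + 2 ∷ + 3 ∷ + 4 ∷ + 5 ∷ - + 3 ∷ - + 2 ∷ - + 1 ∷ []) r

  unit : H₃ → ℤ
  unit = digits (1 ∷ replicate 26 0)

  -unit : H₃ → ℤ
  -unit = digits (2 ∷ replicate 26 0)

  opaque
    unfolding form β Det

    -- Evaluation is feasible because the cofactor is expressed by nine fibre sums and a determinant
    -- of size 3.
    generator-value : ∀ r → at total (generator r) ≡ + 3 * offset r × cofactor (generator r) ≡ + (3 ^ 11)
    generator-value = from-yes (all? λ r →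
      (at total (generator r) Int.≟ + 3 * offset r) ×-dec (cofactor (generator r) Int.≟ + (3 ^ 11)))

    unit-value : at total unit ≡ + 1 × cofactor unit ≡ + 1
    unit-value = from-yes ((at total unit Int.≟ + 1) ×-dec (cofactor unit Int.≟ + 1))

    -unit-value : at total -unit ≡ - + 1 × cofactor -unit ≡ + 1
    -unit-value = from-yes ((at total -unit Int.≟ - + 1) ×-dec (cofactor -unit Int.≟ + 1))

  groupDet-shift : ∀ c f {a b} → at total f ≡ a → cofactor f ≡ b → groupDet (shift c f) ≡ (c * + 27 + a) * b
  groupDet-shift c f total≡ cofactor≡ = ≡.trans (groupDet-cofactor (shift c f))
    (≡.cong₂ _*_ (≡.trans (total-shift c f) (≡.cong (λ a → c * + 27 + a) total≡))
        (≡.trans (cofactor-shift c f) cofactor≡))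

open Values
open ℤP

-- Classification of the values

data Residue9 (a : ℤ) : Set where
  residue9 : ∀ r q → a ≡ q * + 9 + offset r → Residue9 a

divide9 : ∀ a → Residue9 a
divide9 a with a %ℕ 9 | n%ℕd<d a 9 | a /ℕ 9 | a≡a%ℕn+[a/ℕn]*n a 9
... | 0 | _ | q | eq = residue9 0F q (≡.trans eq (ℤₚ.+-comm (+ 0) (q * + 9)))
... | 1 | _ | q | eq = residue9 1F q (≡.trans eq (ℤₚ.+-comm (+ 1) (q * + 9)))
... | 2 | _ | q | eq = residue9 2F q (≡.trans eq (ℤₚ.+-comm (+ 2) (q * + 9)))
... | 3 | _ | q | eq = residue9 3F q (≡.trans eq (ℤₚ.+-comm (+ 3) (q * + 9)))
... | 4 | _ | q | eq = residue9 4F q (≡.trans eq (ℤₚ.+-comm (+ 4) (q * + 9)))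
... | 5 | _ | q | eq = residue9 5F q (≡.trans eq (ℤₚ.+-comm (+ 5) (q * + 9)))
-- From here on the offset is the remainder minus 9, so the quotient rises by one.
... | 6 | _ | q | eq = residue9 6F (+ 1 + q) (≡.trans eq (carry q))
  where
  carry : ∀ q → + 6 + q * + 9 ≡ (+ 1 + q) * + 9 + - + 3
  carry = solve-∀
... | 7 | _ | q | eq = residue9 7F (+ 1 + q) (≡.trans eq (carry q))
  where
  carry : ∀ q → + 7 + q * + 9 ≡ (+ 1 + q) * + 9 + - + 2
  carry = solve-∀
... | 8 | _ | q | eq = residue9 8F (+ 1 + q) (≡.trans eq (carry q))
  where
  carry : ∀ q → + 8 + q * + 9 ≡ (+ 1 + q) * + 9 + - + 1
  carry = solve-∀
... | suc (suc (suc (suc (suc (suc (suc (suc (suc _)))))))) | s≤s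
    (s≤s (s≤s (s≤s (s≤s (s≤s (s≤s (s≤s (s≤s ())))))))) | _ | _

data Classification (m : ℤ) : Set where
  divisible : ∀ q → m ≡ + (3 ^ 12) * q → Classification m
  plus-one  : ∀ q → m ≡ + 1 + + 27 * q → Classification m
  minus-one : ∀ q → m ≡ - + 1 + + 27 * q → Classification m

collect-27 : ∀ e r q → e + + 27 * r + + 27 * q ≡ e + + 27 * (r + q)
collect-27 = solve-∀

classify : ∀ {D} → Shape D → Classification D
classify {D} S = by-cases (mod3 s)
  where
  open Shape S
  residue-27 : ∃ λ q → shape s w x y z X Y ≡ cube (cube (cube s)) + + 27 * q
  residue-27 = Congruences.shape-mod-27 {s} {w} {x} {y} {z} {X} {E} {K} {F} sum≡ pairs≡ X≡ Y
  reduce : ∀ e → (∃ λ q → cube (cube (cube s)) ≡ e + + 27 * q) → ∃ λ q → D ≡ e + + 27 * q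
  reduce e (r , eq) = let (q , eq′) = residue-27 in
    r + q , ≡.trans D≡ (≡.trans eq′ (≡.trans (≡.cong (λ x → x + + 27 * q) eq) (collect-27 e r q)))
  by-cases : Mod3 s → Classification D
  by-cases (0-mod k eq) =
    let (q , eq′) = shape-divisible {s} {w} {x} {y} {z} {X} {E} {K} {F} sum≡ pairs≡ X≡ Y k eq
    in divisible q (≡.trans D≡ eq′)
  by-cases (1-mod k eq) = let (q , eq′) = reduce (+ 1) (27th-power-1-mod {s} k eq) in plus-one q eq′
  by-cases (2-mod k eq) = let (q , eq′) = reduce (- + 1) (27th-power-2-mod {s} k eq) in minus-one q eq′

3^12≡ : + (3 ^ 12) ≡ + 3 * + (3 ^ 11)
3^12≡ = ≡.refl

3∣3^12 : ∀ {m} q → m ≡ + (3 ^ 12) * q → + 3 Signed.∣ m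
3∣3^12 q m≡ = divides (+ (3 ^ 11) * q) (≡.trans m≡ (≡.trans (≡.cong (_* q) 3^12≡) (lemma (+ (3 ^ 11)) q)))
  where
  lemma : ∀ a q → + 3 * a * q ≡ a * q * + 3
  lemma = solve-∀

27*q : ∀ e q → e + + 27 * q ≡ e + + 3 * (+ 9 * q)
27*q = solve-∀

groupDet-shift-divisible : ∀ c f t A N q m → at total f ≡ + 3 * t → cofactor f ≡ A → N ≡ + 3 * A →
                           q ≡ c * + 9 + t → m ≡ q * N → groupDet (shift c f) ≡ m
groupDet-shift-divisible c f t A N q m total≡ cofactor≡ N≡ q≡ m≡ =
  ≡.trans (groupDet-shift c f {+ 3 * t} {A} total≡ cofactor≡)
    (≡.trans (collect c t A) (≡.sym (≡.trans m≡ (≡.cong₂ _*_ q≡ N≡))))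
  where
  collect : ∀ c t a → (c * + 27 + + 3 * t) * a ≡ (c * + 9 + t) * (+ 3 * a)
  collect = solve-∀

-- With cofactor 3¹¹ the sum of the values must be 3q. The residue of q modulo 9 selects the
-- generator, and the quotient is the constant to add, since each unit of it raises the sum by 27.
realise : ∀ m q → m ≡ q * + (3 ^ 12) → InS m
realise m q m≡ = from-residue (divide9 q)
  where
  from-residue : Residue9 q → InS m
  from-residue (residue9 r c q≡) = shift c (generator r) ,
    groupDet-shift-divisible c (generator r) (offset r) (+ (3 ^ 11)) (+ (3 ^ 12)) q m
      (proj₁ (generator-value r)) (proj₂ (generator-value r)) 3^12≡ q≡ m≡

∣⇒quotient : ∀ k m → k ∣ m → ∃ λ q → m ≡ q * k
∣⇒quotient k m k∣m with ∣ᵤ⇒∣ {k} {m} k∣m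
... | divides q eq = q , eq

quotient⇒∣ : ∀ k m q → m ≡ q * k → k ∣ m
quotient⇒∣ k m q eq = ∣⇒∣ᵤ {k} {m} (divides q eq)

groupDet-unit : ∀ e f q {m} → at total f ≡ e → cofactor f ≡ + 1 → m ≡ e + + 27 * q → groupDet (shift q f) ≡ m
groupDet-unit e f q total≡ cofactor≡ m≡ =
  ≡.trans (groupDet-shift q f {e} {+ 1} total≡ cofactor≡) (≡.trans (collect e q) (≡.sym m≡))
  where
  collect : ∀ e q → (q * + 27 + e) * + 1 ≡ e + + 27 * q
  collect = solve-∀

not-divisible-by-3 : ∀ {D} → Shape D → ¬ (+ 3 ∣ D) → (+ 27 ∣ (D - + 1)) ⊎ (+ 27 ∣ (D + + 1))
not-divisible-by-3 {D} S 3∤D with classify S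
... | divisible q eq = ⊥-elim (3∤D (∣⇒∣ᵤ {+ 3} {D} (3∣3^12 q eq)))
... | plus-one q eq  = inj₁ (quotient⇒∣ (+ 27) (D - + 1) q (≡.trans (≡.cong (_- + 1) eq) (lemma q)))
  where
  lemma : ∀ q → + 1 + + 27 * q - + 1 ≡ q * + 27
  lemma = solve-∀
... | minus-one q eq = inj₂ (quotient⇒∣ (+ 27) (D + + 1) q (≡.trans (≡.cong (λ x → x + + 1) eq) (lemma q)))
  where
  lemma : ∀ q → - + 1 + + 27 * q + + 1 ≡ q * + 27
  lemma = solve-∀

divisible-by-3 : ∀ {D} → Shape D → + 3 ∣ D → + (3 ^ 12) ∣ D
divisible-by-3 {D} S 3∣D with classify S
... | divisible q eq = quotient⇒∣ (+ (3 ^ 12)) D q (≡.trans eq (ℤₚ.*-comm (+ (3 ^ 12)) q))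
... | plus-one q eq  = ⊥-elim (not-1-mod-3 (+ 9 * q) (≡.trans eq (27*q (+ 1) q)) (∣ᵤ⇒∣ {+ 3} {D} 3∣D))
... | minus-one q eq = ⊥-elim (not-2-mod-3 (+ 9 * q) (≡.trans eq (27*q (- + 1) q)) (∣ᵤ⇒∣ {+ 3} {D} 3∣D))

realise-1-mod-27 : ∀ m → + 27 ∣ (m - + 1) → InS m × ¬ (+ 3 ∣ m)
realise-1-mod-27 m 27∣ =
  let (q , eq) = ∣⇒quotient (+ 27) (m - + 1) 27∣
      m≡ : m ≡ + 1 + + 27 * q
      m≡ = ≡.trans (restore m) (≡.trans (≡.cong (λ x → x + + 1) eq) (commute q))
  in (shift q unit , groupDet-unit (+ 1) unit q (proj₁ unit-value) (proj₂ unit-value) m≡)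
   , λ 3∣m → not-1-mod-3 (+ 9 * q) (≡.trans m≡ (27*q (+ 1) q)) (∣ᵤ⇒∣ {+ 3} {m} 3∣m)
  where
  restore : ∀ m → m ≡ m - + 1 + + 1
  restore = solve-∀
  commute : ∀ q → q * + 27 + + 1 ≡ + 1 + + 27 * q
  commute = solve-∀

realise-2-mod-27 : ∀ m → + 27 ∣ (m + + 1) → InS m × ¬ (+ 3 ∣ m)
realise-2-mod-27 m 27∣ =
  let (q , eq) = ∣⇒quotient (+ 27) (m + + 1) 27∣
      m≡ : m ≡ - + 1 + + 27 * q
      m≡ = ≡.trans (restore m) (≡.trans (≡.cong (λ x → x - + 1) eq) (commute q))
  in (shift q -unit , groupDet-unit (- + 1) -unit q (proj₁ -unit-value) (proj₂ -unit-value) m≡)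
   , λ 3∣m → not-2-mod-3 (+ 9 * q) (≡.trans m≡ (27*q (- + 1) q)) (∣ᵤ⇒∣ {+ 3} {m} 3∣m)
  where
  restore : ∀ m → m ≡ m + + 1 - + 1
  restore = solve-∀
  commute : ∀ q → q * + 27 - + 1 ≡ - + 1 + + 27 * q
  commute = solve-∀

realise-divisible : ∀ m → + (3 ^ 12) ∣ m → InS m × (+ 3 ∣ m)
realise-divisible m 3^12∣m =
  let (q , eq) = ∣⇒quotient (+ (3 ^ 12)) m 3^12∣m
  in realise m q eq , ∣⇒∣ᵤ {+ 3} {m} (3∣3^12 q (≡.trans eq (ℤₚ.*-comm q (+ (3 ^ 12)))))

InS⇒Shape : ∀ m → InS m → Shape m
InS⇒Shape m (f , eq) = ≡.subst Shape eq (groupDet-shape f)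

theorem5 : (m : ℤ) →
    ((InS m × ¬ (+ 3 ∣ m)) ⇔ ((+ 27 ∣ (m - + 1)) ⊎ (+ 27 ∣ (m + + 1))))
    × ((InS m × (+ 3 ∣ m)) ⇔ (+ (3 ^ 12) ∣ m))
theorem5 m = 
    mk⇔ (λ { (m∈S , 3∤m) → not-divisible-by-3 (InS⇒Shape m m∈S) 3∤m })
        [ realise-1-mod-27 m , realise-2-mod-27 m ]′
  , mk⇔ (λ { (m∈S , 3∣m) → divisible-by-3 (InS⇒Shape m m∈S) 3∣m }) (realise-divisible m)
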